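{- Let $f, g \in \mathbb{C}[\mathbf{z}] = \mathbb{C}[z_1,\ldots,z_n]$ be such that the polynomial $g(\mathbf{z}) + y f(\mathbf{z}) \in \mathbb{C}[\mathbf{z}, y]$ is stable, and assume that $\rho_{\mathbf{v}}(f) \le 1$ for some $\mathbf{v} \in \mathbb{R}^n_{\ge 0}$. Then $g(\mathbf{z}) - \partial_{\mathbf{v}} f(\mathbf{z}) \in \mathbb{C}[\mathbf{z}]$ is stable or identically $0$.
   Context: A polynomial $h\in\mathbb{C}[z_1,\dots,z_m]$ is called stable if $h(\mathbf{z})\neq 0$ for all $\mathbf{z}\in\mathbb{C}^m$ with $\mathrm{Im}(z_j)>0$ for all $j=1,\dots,m$. For $\mathbf{v}\in\mathbb{R}^n$, $\partial_{\mathbf{v}} f(\mathbf{z})=\frac{d}{dt} f(\mathbf{z}+t\mathbf{v})\big|_{t=0}$ is the directional derivative, and $\rho_{\mathbf{v}}(f)$, the degree of $f$ in direction $\mathbf{v}$, is the degree of the univariate polynomial $f(\mathbf{w}+t\mathbf{v})\in\mathbb{C}[t]$ for generic $\mathbf{w}\in\mathbb{C}^n$. -}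

module Defs where

open import Level using (Level; _⊔_) renaming (suc to lsuc)
open import Algebra.Bundles.Raw using (RawRing)
open import Algebra.Core using (Op₁; Op₂)
open import Algebra.Structures using (IsCommutativeRing)
import Algebra.Definitions.RawMonoid as RawMonoidDefinitions
open import Data.List.Base using (List; []; _∷_; map)
open import Data.Nat.Base using (ℕ; zero; suc)
open import Data.Product.Base using (_×_; ∃-syntax)
open import Data.Vec.Base as Vec using (Vec; []; _∷_)
open import Data.Vec.Relation.Unary.All using (All)
open import Function.Base using (_∘_; id)
open import Relation.Binary.Core using (Rel)
open import Relation.Binary.Definitions using (Decidable)
open import Relation.Binary.PropositionalEquality.Core using (_≡_)
open import Relation.Binary.Structures using (IsStrictTotalOrder)
open import Relation.Nullary.Construct.Add.Infimum using (_₋; ⊥₋; [_])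
open import Relation.Nullary.Decidable.Core using (yes; no; _×-dec_)
open import Relation.Nullary.Negation.Core using (¬_)
open import Relation.Unary using (Pred; Satisfiable)
import Relation.Binary.Construct.StrictToNonStrict as ToNonStrict

private
  variable
    a b ℓ ℓ′ : Level

-- The axioms characterising ℝ up to isomorphism, in classical form:
-- the order satisfies trichotomy, and suprema exist for all inhabited
-- predicates that are bounded above.

record CompleteOrderedField c ℓ₁ ℓ₂ : Set (lsuc (c ⊔ ℓ₁ ⊔ ℓ₂)) where
  infix  8 -_
  infixl 7 _*_
  infixl 6 _+_
  infix  4 _≈_ _<_
  field
    Carrier            : Set c
    _≈_                : Rel Carrier ℓ₁
    _<_                : Rel Carrier ℓ₂
    _+_ _*_            : Op₂ Carrier
    -_                 : Op₁ Carrier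
    0# 1#              : Carrier
    isCommutativeRing  : IsCommutativeRing _≈_ _+_ _*_ -_ 0# 1#
    isStrictTotalOrder : IsStrictTotalOrder _≈_ _<_
    1≉0                : ¬ (1# ≈ 0#)
    inverse            : ∀ x → ¬ (x ≈ 0#) → ∃[ y ] (x * y ≈ 1#)
    +-monoˡ-<          : ∀ {x y} z → x < y → x + z < y + z
    *-positive         : ∀ {x y} → 0# < x → 0# < y → 0# < x * y

  open ToNonStrict _≈_ _<_ public using (_≤_)

  UpperBound : ∀ {p} → Pred Carrier p → Carrier → Set (c ⊔ ℓ₁ ⊔ ℓ₂ ⊔ p)
  UpperBound P u = ∀ x → P x → x ≤ u

  field
    supremum : (P : Pred Carrier (c ⊔ ℓ₁ ⊔ ℓ₂)) →
               Satisfiable P → ∃[ u ] UpperBound P u →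
               ∃[ s ] (UpperBound P s × (∀ u → UpperBound P u → s ≤ u))

-- Univariate polynomials over K are coefficient lists, constant
-- coefficient first. Trailing zeros are allowed; equality is
-- coefficientwise and hence ignores them.

module Univariate (K : RawRing a ℓ) where
  open RawRing K
  open RawMonoidDefinitions +-rawMonoid using () renaming (_×_ to _·_)

  coeff : List Carrier → ℕ → Carrier
  coeff []      _       = 0#
  coeff (x ∷ _) zero    = x
  coeff (_ ∷ p) (suc k) = coeff p k

  add : Op₂ (List Carrier)
  add []      q       = q
  add p       []      = p
  add (x ∷ p) (y ∷ q) = (x + y) ∷ add p q

  mul : Op₂ (List Carrier)
  mul []      _ = []
  mul (x ∷ p) q = add (map (x *_) q) (0# ∷ mul p q)

  const : Carrier → List Carrier
  const x = x ∷ []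

  X : List Carrier
  X = 0# ∷ 1# ∷ []

  rawRing : RawRing a ℓ
  rawRing = record
    { Carrier = List Carrier
    ; _≈_     = λ p q → ∀ k → coeff p k ≈ coeff q k
    ; _+_     = add
    ; _*_     = mul
    ; -_      = map (-_)
    ; 0#      = []
    ; 1#      = const 1#
    }

  evalAt : Carrier → List Carrier → Carrier
  evalAt x []      = 0#
  evalAt x (y ∷ p) = y + x * evalAt x p

  derivative : List Carrier → List Carrier
  derivative []      = []
  derivative (_ ∷ p) = go 1 p
    where
    go : ℕ → List Carrier → List Carrier
    go _ []      = []
    go k (y ∷ q) = (k · y) ∷ go (suc k) q

  -- ⊥₋ plays the role of -∞, the degree of the zero polynomial.

  degree : Decidable _≈_ → List Carrier → ℕ ₋
  degree _≟_ []      = ⊥₋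
  degree _≟_ (x ∷ p) with degree _≟_ p | x ≟ 0#
  ... | [ d ] | _     = [ suc d ]
  ... | ⊥₋    | yes _ = ⊥₋
  ... | ⊥₋    | no  _ = [ 0 ]

_[X] : RawRing a ℓ → RawRing a ℓ
K [X] = Univariate.rawRing K

-- K[x₁,…,xₙ] as K[xₙ]…[x₂][x₁]: the first variable is the outermost one.

_[X^_] : RawRing a ℓ → ℕ → RawRing a ℓ
K [X^ zero  ] = K
K [X^ suc n ] = K [X^ n ] [X]

module Multivariate (K : RawRing a ℓ) where
  private module K = RawRing K

  Poly : ℕ → Set a
  Poly n = RawRing.Carrier (K [X^ n ])

  constant : ∀ n → K.Carrier → Poly n
  constant zero    x = x
  constant (suc n) x = Univariate.const (K [X^ n ]) (constant n x)

  variables : ∀ n → Vec (Poly n) n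
  variables zero    = []
  variables (suc n) = Univariate.X (K [X^ n ])
                    ∷ Vec.map (Univariate.const (K [X^ n ])) (variables n)

  substitute : (S : RawRing b ℓ′) (ι : K.Carrier → RawRing.Carrier S) →
               ∀ n → Poly n → Vec (RawRing.Carrier S) n → RawRing.Carrier S
  substitute S ι zero    x _        = ι x
  substitute S ι (suc n) p (s ∷ ss) = horner p
    where
    open RawRing S using (Carrier; _+_; _*_; 0#)

    horner : List (Poly n) → Carrier
    horner []      = 0#
    horner (q ∷ r) = substitute S ι n q ss + s * horner r

  eval : ∀ n → Poly n → Vec K.Carrier n → K.Carrier
  eval = substitute K id

  -- f(w + t v) as a polynomial in t with coefficients in S.

  alongLine : (S : RawRing b ℓ′) (ι : K.Carrier → RawRing.Carrier S) →
              ∀ n → Poly n → Vec (RawRing.Carrier S) n → Vec K.Carrier n →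
              RawRing.Carrier (S [X])
  alongLine S ι n f w v =
    substitute (S [X]) (const ∘ ι) n f
      (Vec.zipWith (λ wᵢ vᵢ → const wᵢ + X * const (ι vᵢ)) w v)
    where
    open Univariate S using (const; X)
    open RawRing (S [X]) using (_+_; _*_)

  -- The t-derivative at t = 0 of f(z + t v), the latter taken in K[z][t].

  directionalDerivative : ∀ n → Vec K.Carrier n → Poly n → Poly n
  directionalDerivative n v f =
    evalAt 0# (derivative (alongLine (K [X^ n ]) (constant n) n f (variables n) v))
    where
    open Univariate (K [X^ n ]) using (evalAt; derivative)
    open RawRing (K [X^ n ]) using (0#)

module Complex {c ℓ₁ ℓ₂} (ℝ : CompleteOrderedField c ℓ₁ ℓ₂) where
  open CompleteOrderedField ℝ
  open IsStrictTotalOrder isStrictTotalOrder using (_≟_)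

  infix 5 _+i_

  record ℂ : Set c where
    constructor _+i_
    field
      re im : Carrier

  open ℂ public

  ℂ-rawRing : RawRing c ℓ₁
  ℂ-rawRing = record
    { Carrier = ℂ
    ; _≈_     = λ z w → (re z ≈ re w) × (im z ≈ im w)
    ; _+_     = λ z w → (re z + re w) +i (im z + im w)
    ; _*_     = λ z w → (re z * re w + - (im z * im w)) +i
                        (re z * im w + im z * re w)
    ; -_      = λ z → (- re z) +i (- im z)
    ; 0#      = 0# +i 0#
    ; 1#      = 1# +i 0#
    }

  open RawRing ℂ-rawRing using () renaming (_≈_ to _≈ᶜ_; 0# to 0ᶜ)

  _≟ᶜ_ : Decidable _≈ᶜ_
  z ≟ᶜ w = (re z ≟ re w) ×-dec (im z ≟ im w)

  fromℝ : Carrier → ℂ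
  fromℝ x = x +i 0#

  open Multivariate ℂ-rawRing public using (Poly; eval)
  open Multivariate ℂ-rawRing using (alongLine; directionalDerivative)

  Stable : ∀ m → Poly m → Set (c ⊔ ℓ₁ ⊔ ℓ₂)
  Stable m h = ∀ z → All (λ zⱼ → 0# < im zⱼ) z → ¬ (eval m h z ≈ᶜ 0ᶜ)

  ∂ : ∀ n → Vec Carrier n → Poly n → Poly n
  ∂ n v = directionalDerivative n (Vec.map fromℝ v)

  -- Generic means: off the zero set of some nonzero polynomial.

  Generically : ∀ n {p} → Pred (Vec ℂ n) p → Set (c ⊔ ℓ₁ ⊔ p)
  Generically n P = ∃[ q ] (¬ (q ≈ₙ 0ₙ) × (∀ w → ¬ (eval n q w ≈ᶜ 0ᶜ) → P w))
    where open RawRing (ℂ-rawRing [X^ n ]) using () renaming (_≈_ to _≈ₙ_; 0# to 0ₙ)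

  -- ρ n v f d says that d is the degree of f in direction v. The zero
  -- polynomial has degree ⊥₋ in every direction.

  ρ : ∀ n → Vec Carrier n → Poly n → ℕ ₋ → Set (c ⊔ ℓ₁)
  ρ n v f d = Generically n λ w →
    degree _≟ᶜ_ (alongLine ℂ-rawRing id n f w (Vec.map fromℝ v)) ≡ d
    where open Univariate ℂ-rawRing using (degree)

{-# OPTIONS --safe #-}
module Submission where

-- Write D = ∂_v f. Stability of g + y f says Im (g / f) ≥ 0 on ℍⁿ. If f has a
-- zero in ℍⁿ, then f ≡ 0, by the minimum principle below applied to −f / g.
-- Otherwise f(z + t v) = f(z) + t D(z) has no zero t in the upper half-plane,
-- so Im (D / f) ≤ 0, and thus Im ((g − D) / f) ≥ 0 on ℍⁿ. By the minimum
-- principle, g − D vanishes identically as soon as it has a zero in ℍⁿ.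
--
-- Minimum principle: if Im (p / q) ≥ 0 on ℍⁿ, p(z₀) = 0 and q(z₀) ≠ 0, then
-- p ≡ 0. Restrict to a complex line through z₀. If p does not vanish on it,
-- then p / q behaves like c tᵏ with k ≥ 1 near z₀. Some ω makes c ωᵏ lie in
-- the lower half-plane, which contradicts Im (p / q) ≥ 0 at t = s ω for small
-- s > 0. Such an ω is found using only square roots of positive reals.
--
-- The genericity in the definition of ρ disappears because a polynomial that
-- vanishes off the zero set of a nonzero polynomial vanishes everywhere.
open import Defs
open import Algebra.Bundles using (CommutativeRing)
open import Algebra.Bundles.Raw using (RawRing)
import Algebra.Morphism.Construct.Identity as Identity
open import Algebra.Morphism.Structures using (module RingMorphisms)
import Algebra.Properties.AbelianGroup as AbelianGroupProperties
import Algebra.Properties.CommutativeSemigroup as CommutativeSemigroupProperties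
import Algebra.Properties.CommutativeSemiring.Exp as Exponentiation
import Algebra.Properties.Ring as RingProperties
import Algebra.Properties.Semiring.Mult as SemiringMultiplication
import Algebra.Solver.Ring as RingSolver
open import Algebra.Solver.Ring.AlmostCommutativeRing
  using (fromCommutativeRing; _-Raw-AlmostCommutative⟶_)
open import Data.List.Base using (List; []; _∷_; map)
open import Data.Maybe.Base using (Maybe; just; nothing)
import Data.Nat.Base as ℕ
open import Data.Nat.Base using (ℕ; zero; suc)
open import Data.Nat.Induction using (<-rec)
import Data.Nat.Properties as ℕ
open import Data.Product.Base using (_×_; _,_; proj₁; proj₂; ∃-syntax; uncurry)
open import Data.Sum.Base using (_⊎_; inj₁; inj₂)
open import Data.Vec.Base as Vec using (Vec; []; _∷_)
open import Data.Vec.Relation.Binary.Pointwise.Inductive as Pointwise using (Pointwise; []; _∷_)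
open import Data.Vec.Relation.Unary.All using (All; []; _∷_)
open import Function.Base using (_∘_; id)
open import Level using (_⊔_; Lift; lift; lower)
open import Relation.Binary.Construct.Add.Infimum.NonStrict ℕ._≤_ using (_≤₋_; [_])
open import Relation.Binary.Definitions using (Tri; tri<; tri≈; tri>)
open import Relation.Binary.PropositionalEquality.Core as ≡ using (_≡_)
import Relation.Binary.Reasoning.Setoid as SetoidReasoning
open import Relation.Binary.Structures using (IsStrictTotalOrder)
open import Relation.Nullary.Construct.Add.Infimum using (_₋; ⊥₋; [_])
open import Relation.Nullary.Decidable.Core using (Dec; yes; no; decidable-stable; map′; _×-dec_)
open import Relation.Nullary.Negation.Core using (¬_; contradiction)
open import Relation.Unary using (Pred)

-- Quotients never appear. A sign condition on Im (p / q) is stated through `cross`, which is |q|²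
-- Im (p / q) and takes the value 0 where q vanishes. So the minimum principle can ask for its sign
-- condition on all of ℍⁿ, while q ≠ 0 is asked at z₀ alone. The analytic input is a single fact: a
-- real polynomial that is negative at 0 stays negative just to the right of 0. Taking |z|² or
-- `cross` of complex polynomials along a ray turns complex statements into such sign statements,
-- with no notion of continuity. Extracting k-th roots of arbitrary complex numbers would need much
-- more than square roots. It is enough to rotate by 1, -1, 𝕚 or -𝕚: one of them takes any given
-- nonzero number into the lower half-plane. Completeness of ℝ serves only to provide the square
-- roots behind these rotations. The condition v ≥ 0 enters once: it keeps z + t v in ℍⁿ for t in
-- the upper half-plane.

-- Ring solver with integer coefficients over any commutative ring.

module IntegerSolver {c ℓ} (R : CommutativeRing c ℓ) where
  open CommutativeRing R
  open RingProperties ring using (x[y-z]≈xy-xz; [y-z]x≈yx-zx)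
  open AbelianGroupProperties +-abelianGroup using (⁻¹-∙-comm; ⁻¹-anti-homo‿-; ε⁻¹≈ε)
  open CommutativeSemigroupProperties +-commutativeSemigroup using (interchange)
  open SemiringMultiplication semiring using (×-homo-+; ×1-homo-*; ×-congˡ) renaming (_×_ to _·_)
  open SetoidReasoning setoid

  -- The pair (a , b) stands for the integer a − b.
  differences : RawRing _ _
  differences = record
    { Carrier = ℕ × ℕ
    ; _≈_     = _≡_
    ; _+_     = λ { (a , b) (c , d) → a ℕ.+ c , b ℕ.+ d }
    ; _*_     = λ { (a , b) (c , d) → a ℕ.* c ℕ.+ b ℕ.* d , a ℕ.* d ℕ.+ b ℕ.* c }
    ; -_      = λ { (a , b) → b , a }
    ; 0#      = 0 , 0
    ; 1#      = 1 , 0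
    }

  value : ℕ × ℕ → Carrier
  value (a , b) = a · 1# - b · 1#

  -- Agrees with value, but depends on the difference only, and sends 0 and 1
  -- to 0# and 1#, up to definitional equality.
  ⟦_⟧ᶜ : ℕ × ℕ → Carrier
  ⟦ suc a , suc b ⟧ᶜ = ⟦ a , b ⟧ᶜ
  ⟦ 0     , 0     ⟧ᶜ = 0#
  ⟦ 1     , 0     ⟧ᶜ = 1#
  ⟦ x             ⟧ᶜ = value x

  private
    differences-+ : ∀ w x y z → (w + x) - (y + z) ≈ (w - y) + (x - z)
    differences-+ w x y z = begin
      (w + x) - (y + z)         ≈⟨ +-congˡ (⁻¹-∙-comm y z) ⟨
      (w + x) + (- y - z)       ≈⟨ interchange w x (- y) (- z) ⟩
      (w - y) + (x - z)         ∎

    differences-* : ∀ w x y z → (w * y + x * z) - (w * z + x * y) ≈ (w - x) * (y - z)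
    differences-* w x y z = begin
      (w * y + x * z) - (w * z + x * y)     ≈⟨ differences-+ _ _ _ _ ⟩
      (w * y - w * z) + (x * z - x * y)     ≈⟨ +-congˡ (⁻¹-anti-homo‿- _ _) ⟨
      (w * y - w * z) - (x * y - x * z)     ≈⟨ +-cong (x[y-z]≈xy-xz w y z) (-‿cong (x[y-z]≈xy-xz x y z)) ⟨
      w * (y - z) - x * (y - z)             ≈⟨ [y-z]x≈yx-zx _ _ _ ⟨
      (w - x) * (y - z)                     ∎

    differences-≈ : ∀ w x y z → w + z ≈ y + x → w - x ≈ y - z
    differences-≈ w x y z eq = begin
      w - x                 ≈⟨ +-identityʳ _ ⟨
      (w - x) + 0#          ≈⟨ +-congˡ (-‿inverseʳ z) ⟨
      (w - x) + (z - z)     ≈⟨ differences-+ _ _ _ _ ⟨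
      (w + z) - (x + z)     ≈⟨ +-cong eq (-‿cong (+-comm x z)) ⟩
      (y + x) - (z + x)     ≈⟨ differences-+ _ _ _ _ ⟩
      (y - z) + (x - x)     ≈⟨ +-congˡ (-‿inverseʳ x) ⟩
      (y - z) + 0#          ≈⟨ +-identityʳ _ ⟩
      y - z                 ∎

    ⟦⟧ᶜ≈value : ∀ x → ⟦ x ⟧ᶜ ≈ value x
    ⟦⟧ᶜ≈value (suc a , suc b)     = trans (⟦⟧ᶜ≈value (a , b))
      (sym (differences-≈ (suc a · 1#) (suc b · 1#) (a · 1#) (b · 1#) (begin
        suc a · 1# + b · 1#       ≈⟨ ×-homo-+ 1# (suc a) b ⟨
        (suc a ℕ.+ b) · 1#        ≈⟨ ×-congˡ (ℕ.+-suc a b) ⟨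
        (a ℕ.+ suc b) · 1#        ≈⟨ ×-homo-+ 1# a (suc b) ⟩
        a · 1# + suc b · 1#       ∎)))
    ⟦⟧ᶜ≈value (0 , 0)             = sym (-‿inverseʳ 0#)
    ⟦⟧ᶜ≈value (1 , 0)             = sym (begin
      1# + 0# - 0#    ≈⟨ +-cong (+-identityʳ 1#) ε⁻¹≈ε ⟩
      1# + 0#         ≈⟨ +-identityʳ 1# ⟩
      1#              ∎)
    ⟦⟧ᶜ≈value (0 , suc b)         = refl
    ⟦⟧ᶜ≈value (suc (suc a) , 0)   = refl

    module D = RawRing differences

    value-+ : ∀ x y → value (x D.+ y) ≈ value x + value y
    value-+ (a , b) (c , d) =
      trans (+-cong (×-homo-+ 1# a c) (-‿cong (×-homo-+ 1# b d)))
            (differences-+ _ _ _ _)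

    product-sum : ∀ a b c d → (a ℕ.* b ℕ.+ c ℕ.* d) · 1# ≈ (a · 1#) * (b · 1#) + (c · 1#) * (d · 1#)
    product-sum a b c d =
      trans (×-homo-+ 1# (a ℕ.* b) (c ℕ.* d)) (+-cong (×1-homo-* a b) (×1-homo-* c d))

    value-* : ∀ x y → value (x D.* y) ≈ value x * value y
    value-* (a , b) (c , d) =
      trans (+-cong (product-sum a c b d) (-‿cong (product-sum a d b c)))
            (differences-* _ _ _ _)

    morphism : differences -Raw-AlmostCommutative⟶ fromCommutativeRing R
    morphism = record
      { ⟦_⟧    = ⟦_⟧ᶜ
      ; +-homo = λ x y → trans (⟦⟧ᶜ≈value (x D.+ y)) (trans (value-+ x y)
                           (sym (+-cong (⟦⟧ᶜ≈value x) (⟦⟧ᶜ≈value y))))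
      ; *-homo = λ x y → trans (⟦⟧ᶜ≈value (x D.* y)) (trans (value-* x y)
                           (sym (*-cong (⟦⟧ᶜ≈value x) (⟦⟧ᶜ≈value y))))
      ; -‿homo = λ x → trans (⟦⟧ᶜ≈value (D.- x)) (trans (sym (⁻¹-anti-homo‿- _ _))
                           (sym (-‿cong (⟦⟧ᶜ≈value x))))
      ; 0-homo = refl
      ; 1-homo = refl
      }

    -- Integers a - b and c - d are compared by cross-addition. A failed test refutes nothing: in
    -- positive characteristic distinct integers may have equal values.
    _≟ᵥ_ : ∀ x y → Maybe (⟦ x ⟧ᶜ ≈ ⟦ y ⟧ᶜ)
    x@(a , b) ≟ᵥ y@(c , d) with a ℕ.+ d ℕ.≟ c ℕ.+ b
    ... | no  _  = nothing
    ... | yes eq = just (trans (⟦⟧ᶜ≈value x) (trans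
      (differences-≈ (a · 1#) (b · 1#) (c · 1#) (d · 1#)
        (trans (sym (×-homo-+ 1# a d)) (trans (×-congˡ eq) (×-homo-+ 1# c b))))
      (sym (⟦⟧ᶜ≈value y))))

  open RingSolver differences (fromCommutativeRing R) morphism _≟ᵥ_ public
    using (solve; con; _:+_; _:*_; _:-_; :-_; _:=_; Polynomial)

  :0 :1 : ∀ {n} → Polynomial n
  :0 = con (0 , 0)
  :1 = con (1 , 0)

-- Horner's scheme behind `substitute`.

module Substitution {a b ℓ ℓ′} (K : RawRing a ℓ) (S : RawRing b ℓ′)
         (ι : RawRing.Carrier K → RawRing.Carrier S) where
  open Multivariate K
  open RawRing S

  private
    -- The argument in `P` is the list on which the recursion was started. Both equations ignore it,
    -- so the values do too; hence the recursion started on q ∷ r agrees on r with the one started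
    -- on r itself.
    recursion-unique : ∀ {x y} {P : Set x} {Q : Set y} (H : P → List Q → Carrier) (f : Q → Carrier) s →
                       (∀ p → H p [] ≡ 0#) → (∀ p q r → H p (q ∷ r) ≡ f q + s * H p r) →
                       ∀ p p′ r → H p r ≡ H p′ r
    recursion-unique H f s H-[] H-∷ p p′ []      = ≡.trans (H-[] p) (≡.sym (H-[] p′))
    recursion-unique H f s H-[] H-∷ p p′ (q ∷ r) =
      ≡.trans (H-∷ p q r) (≡.trans
        (≡.cong (λ x → f q + s * x) (recursion-unique H f s H-[] H-∷ p p′ r))
        (≡.sym (H-∷ p′ q r)))

  -- substitute recurses through a local function that also depends on the whole
  -- list p it was started on, and that has no name outside. It is recovered
  -- here by unification: generalising q ∷ r to p in the goal separates its two
  -- list arguments, which makes the constraint on horner′ a pattern.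
  mutual
    private
      horner′ : ∀ n → Poly (suc n) → Carrier → Vec Carrier n → List (Poly n) → Carrier
      horner′ = _

    substitute-∷ : ∀ n (q : Poly n) (r : Poly (suc n)) s ss →
                   substitute S ι (suc n) (q ∷ r) (s ∷ ss)
                   ≡ substitute S ι n q ss + s * substitute S ι (suc n) r (s ∷ ss)
    substitute-∷ n q r s ss with q ∷ r
    ... | p = ≡.cong (λ x → substitute S ι n q ss + s * x)
      (recursion-unique (λ p r → horner′ n p s ss r) (λ q → substitute S ι n q ss) s
        (λ _ → ≡.refl) (λ _ _ _ → ≡.refl) p r r)

-- Evaluation of polynomials as a ring homomorphism.

module Evaluation {c ℓ} (R : CommutativeRing c ℓ) where
  open CommutativeRing R
  open Multivariate rawRing
  open SetoidReasoning setoid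
  open IntegerSolver R
  open RingMorphisms using (IsRingHomomorphism)

  eval-∷ : ∀ n (q : Poly n) (r : Poly (suc n)) t z →
           eval (suc n) (q ∷ r) (t ∷ z) ≈ eval n q z + t * eval (suc n) r (t ∷ z)
  eval-∷ n q r t z = reflexive (Substitution.substitute-∷ rawRing rawRing id n q r t z)

  module _ {n} {z : Vec Carrier n} (t : Carrier)
           (isHom : IsRingHomomorphism (rawRing [X^ n ]) rawRing (λ p → eval n p z)) where
    private
      module Rₙ = RawRing (rawRing [X^ n ])
      module Rₙ[X] = RawRing (rawRing [X^ suc n ])
      open IsRingHomomorphism isHom

      φ : Poly n → Carrier
      φ p = eval n p z

      ev : Poly (suc n) → Carrier
      ev p = eval (suc n) p (t ∷ z)

      ev-∷ : ∀ x p → ev (x ∷ p) ≈ φ x + t * ev p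
      ev-∷ x p = eval-∷ n x p t z

      ev-≈0 : ∀ p → p Rₙ[X].≈ Rₙ[X].0# → ev p ≈ 0#
      ev-≈0 []      _  = refl
      ev-≈0 (x ∷ p) eq = begin
        ev (x ∷ p)      ≈⟨ ev-∷ x p ⟩
        φ x + t * ev p  ≈⟨ +-cong (trans (⟦⟧-cong (eq 0)) 0#-homo)
                                  (*-congˡ (ev-≈0 p (eq ∘ suc))) ⟩
        0# + t * 0#     ≈⟨ solve 1 (λ t → :0 :+ t :* :0 := :0) refl t ⟩
        0#              ∎

      -- In a raw ring ≈ need not be symmetric, hence the separate clause for [].
      0≈ev : ∀ p → Rₙ[X].0# Rₙ[X].≈ p → 0# ≈ ev p
      0≈ev []      _  = refl
      0≈ev (x ∷ p) eq = begin
        0#              ≈⟨ solve 1 (λ t → :0 := :0 :+ t :* :0) refl t ⟩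
        0# + t * 0#     ≈⟨ +-cong (trans (sym 0#-homo) (⟦⟧-cong (eq 0)))
                                  (*-congˡ (0≈ev p (eq ∘ suc))) ⟩
        φ x + t * ev p  ≈⟨ ev-∷ x p ⟨
        ev (x ∷ p)      ∎

      ev-cong : ∀ p q → p Rₙ[X].≈ q → ev p ≈ ev q
      ev-cong []      q       eq = 0≈ev q eq
      ev-cong (x ∷ p) []      eq = ev-≈0 (x ∷ p) eq
      ev-cong (x ∷ p) (y ∷ q) eq = begin
        ev (x ∷ p)      ≈⟨ ev-∷ x p ⟩
        φ x + t * ev p  ≈⟨ +-cong (⟦⟧-cong (eq 0)) (*-congˡ (ev-cong p q (eq ∘ suc))) ⟩
        φ y + t * ev q  ≈⟨ ev-∷ y q ⟨
        ev (y ∷ q)      ∎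

      ev-+ : ∀ p q → ev (p Rₙ[X].+ q) ≈ ev p + ev q
      ev-+ []      q       = sym (+-identityˡ (ev q))
      ev-+ (x ∷ p) []      = sym (+-identityʳ (ev (x ∷ p)))
      ev-+ (x ∷ p) (y ∷ q) = begin
        ev (x Rₙ.+ y ∷ p Rₙ[X].+ q)           ≈⟨ ev-∷ (x Rₙ.+ y) (p Rₙ[X].+ q) ⟩
        φ (x Rₙ.+ y) + t * ev (p Rₙ[X].+ q)   ≈⟨ +-cong (+-homo x y) (*-congˡ (ev-+ p q)) ⟩
        (φ x + φ y) + t * (ev p + ev q)       ≈⟨ solve 5 (λ x y t p q →
          (x :+ y) :+ t :* (p :+ q) := (x :+ t :* p) :+ (y :+ t :* q)) refl _ _ _ _ _ ⟩
        (φ x + t * ev p) + (φ y + t * ev q)   ≈⟨ +-cong (ev-∷ x p) (ev-∷ y q) ⟨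
        ev (x ∷ p) + ev (y ∷ q)               ∎

      ev-scale : ∀ x q → ev (map (x Rₙ.*_) q) ≈ φ x * ev q
      ev-scale x []      = sym (zeroʳ (φ x))
      ev-scale x (y ∷ q) = begin
        ev (x Rₙ.* y ∷ map (x Rₙ.*_) q)           ≈⟨ ev-∷ (x Rₙ.* y) (map (x Rₙ.*_) q) ⟩
        φ (x Rₙ.* y) + t * ev (map (x Rₙ.*_) q)   ≈⟨ +-cong (*-homo x y) (*-congˡ (ev-scale x q)) ⟩
        φ x * φ y + t * (φ x * ev q)              ≈⟨ solve 4 (λ x y t q →
          x :* y :+ t :* (x :* q) := x :* (y :+ t :* q)) refl _ _ _ _ ⟩
        φ x * (φ y + t * ev q)                    ≈⟨ *-congˡ (ev-∷ y q) ⟨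
        φ x * ev (y ∷ q)                          ∎

      ev-* : ∀ p q → ev (p Rₙ[X].* q) ≈ ev p * ev q
      ev-* []      q = sym (zeroˡ (ev q))
      ev-* (x ∷ p) q = begin
        ev (map (x Rₙ.*_) q Rₙ[X].+ (Rₙ.0# ∷ p Rₙ[X].* q))    ≈⟨ ev-+ (map (x Rₙ.*_) q) _ ⟩
        ev (map (x Rₙ.*_) q) + ev (Rₙ.0# ∷ p Rₙ[X].* q)       ≈⟨ +-cong (ev-scale x q)
                                                                  (ev-∷ Rₙ.0# (p Rₙ[X].* q)) ⟩
        φ x * ev q + (φ Rₙ.0# + t * ev (p Rₙ[X].* q))         ≈⟨ +-congˡ
                                                    (+-cong 0#-homo (*-congˡ (ev-* p q))) ⟩
        φ x * ev q + (0# + t * (ev p * ev q))                 ≈⟨ solve 4 (λ x q t p →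
          x :* q :+ (:0 :+ t :* (p :* q)) := (x :+ t :* p) :* q) refl _ _ _ _ ⟩
        (φ x + t * ev p) * ev q                               ≈⟨ *-congʳ (ev-∷ x p) ⟨
        ev (x ∷ p) * ev q                                     ∎

      ev-neg : ∀ p → ev (Rₙ[X].- p) ≈ - ev p
      ev-neg []      = solve 0 (:0 := :- :0) refl
      ev-neg (x ∷ p) = begin
        ev (Rₙ[X].- (x ∷ p))              ≈⟨ ev-∷ (Rₙ.- x) (Rₙ[X].- p) ⟩
        φ (Rₙ.- x) + t * ev (Rₙ[X].- p)   ≈⟨ +-cong (-‿homo x) (*-congˡ (ev-neg p)) ⟩
        - φ x + t * (- ev p)              ≈⟨ solve 3 (λ x t p →
          :- x :+ t :* (:- p) := :- (x :+ t :* p)) refl _ _ _ ⟩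
        - (φ x + t * ev p)                ≈⟨ -‿cong (ev-∷ x p) ⟨
        - ev (x ∷ p)                      ∎

    -- Evaluation in one more variable is Horner's scheme over the evaluation of the coefficients,
    -- so every law passes from n to n + 1 variables.
    eval-suc-isRingHomomorphism :
      IsRingHomomorphism (rawRing [X^ suc n ]) rawRing (λ p → eval (suc n) p (t ∷ z))
    eval-suc-isRingHomomorphism = record
      { isSemiringHomomorphism = record
        { isNearSemiringHomomorphism = record
          { +-isMonoidHomomorphism = record
            { isMagmaHomomorphism = record
              { isRelHomomorphism = record { cong = λ {p} {q} → ev-cong p q }
              ; homo = ev-+
              }
            ; ε-homo = refl
            }
          ; *-homo = ev-*
          }
        ; 1#-homo = trans (+-cong 1#-homo (zeroʳ t)) (+-identityʳ 1#)
        }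
      ; -‿homo = ev-neg
      }

  eval-isRingHomomorphism : ∀ {n} (z : Vec Carrier n) →
    IsRingHomomorphism (rawRing [X^ n ]) rawRing (λ p → eval n p z)
  eval-isRingHomomorphism []      = Identity.isRingHomomorphism rawRing refl
  eval-isRingHomomorphism (t ∷ z) = eval-suc-isRingHomomorphism t (eval-isRingHomomorphism z)

  module Eval {n} (z : Vec Carrier n) = IsRingHomomorphism (eval-isRingHomomorphism z)

  -- The uniqueness half of the universal property of a polynomial ring: a homomorphism compatible
  -- with the constants is determined by the images of the variables.
  eval-substitute : ∀ {b ℓ′} (S : RawRing b ℓ′) {ι : Carrier → RawRing.Carrier S}
                    {φ : RawRing.Carrier S → Carrier} →
                    IsRingHomomorphism S rawRing φ → (∀ x → φ (ι x) ≈ x) →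
                    ∀ n (p : Poly n) {ss zs} → Pointwise (λ s z → φ s ≈ z) ss zs →
                    φ (substitute S ι n p ss) ≈ eval n p zs
  eval-substitute S isHom φι zero    x       []             = φι x
  eval-substitute S isHom φι (suc n) []      (_ ∷ _)        =
    IsRingHomomorphism.0#-homo isHom
  eval-substitute S {φ = φ} isHom φι (suc n) (q ∷ r) (s≈z ∷ ss≈zs) =
    trans (reflexive (≡.cong φ (Substitution.substitute-∷ rawRing S _ n q r _ _))) (trans (+-homo _ _)
      (trans (+-cong (eval-substitute S isHom φι n q ss≈zs)
        (trans (*-homo _ _) (*-cong s≈z (eval-substitute S isHom φι (suc n) r (s≈z ∷ ss≈zs)))))
      (sym (eval-∷ n q r _ _))))
    where open IsRingHomomorphism isHom

  eval-congʳ : ∀ n (p : Poly n) {z w} → Pointwise _≈_ z w → eval n p z ≈ eval n p w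
  eval-congʳ n p = eval-substitute rawRing (Identity.isRingHomomorphism rawRing refl) (λ _ → refl) n p

  infix 6 _+[_]_
  _+[_]_ : ∀ {n} → Vec Carrier n → Carrier → Vec Carrier n → Vec Carrier n
  w +[ t ] v = Vec.zipWith (λ x y → x + t * y) w v

  eval-constant : ∀ n x (z : Vec Carrier n) → eval n (constant n x) z ≈ x
  eval-constant zero    x []      = refl
  eval-constant (suc n) x (t ∷ z) =
    trans (+-cong (eval-constant n x z) (zeroʳ t)) (+-identityʳ x)

  eval-const : ∀ {n} (p : Poly n) t (z : Vec Carrier n) →
               eval (suc n) (Univariate.const (rawRing [X^ n ]) p) (t ∷ z) ≈ eval n p z
  eval-const p t z = trans (+-congˡ (zeroʳ t)) (+-identityʳ _)

  eval-X : ∀ {n} t (z : Vec Carrier n) →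
           eval (suc n) (Univariate.X (rawRing [X^ n ])) (t ∷ z) ≈ t
  eval-X {n} t z = begin
    eval n Rₙ.0# z + t * (eval n Rₙ.1# z + t * 0#)  ≈⟨ +-cong (Eval.0#-homo z)
                                                         (*-congˡ (+-congʳ (Eval.1#-homo z))) ⟩
    0# + t * (1# + t * 0#)                          ≈⟨ solve 1 (λ t →
      :0 :+ t :* (:1 :+ t :* :0) := t) refl t ⟩
    t                                               ∎
    where module Rₙ = RawRing (rawRing [X^ n ])

  eval-variables : ∀ {n} (z : Vec Carrier n) →
                   Pointwise (λ x zᵢ → eval n x z ≈ zᵢ) (variables n) z
  eval-variables         []      = []
  eval-variables {suc n} (t ∷ z) = eval-X t z ∷ raise (eval-variables z)
    where
    open Univariate (rawRing [X^ n ]) using (const)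
    raise : ∀ {m} {xs : Vec (Poly n) m} {zs : Vec Carrier m} →
            Pointwise (λ x zᵢ → eval n x z ≈ zᵢ) xs zs →
            Pointwise (λ x zᵢ → eval (suc n) x (t ∷ z) ≈ zᵢ) (Vec.map const xs) zs
    raise []                   = []
    raise (_∷_ {x = x} eq eqs) = trans (eval-const x t z) eq ∷ raise eqs

  -- Base points with polynomial coordinates cover both kinds of line: m = 0 gives the line through
  -- a fixed point, as in `ρ`, and m = n with `variables` gives f(z + t v) over the ring of
  -- polynomials in z, from which `directionalDerivative` is defined.
  eval-alongLine : ∀ {m n} (p : Poly n) (ws : Vec (Poly m) n) (v : Vec Carrier n) t (z : Vec Carrier m)
                   {w} → Pointwise (λ x wᵢ → eval m x z ≈ wᵢ) ws w →
                   eval (suc m) (alongLine (rawRing [X^ m ]) (constant m) n p ws v) (t ∷ z)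
                   ≈ eval n p (w +[ t ] v)
  eval-alongLine {m} {n} p ws v t z ws≈w =
    eval-substitute (rawRing [X^ suc m ]) (eval-isRingHomomorphism (t ∷ z))
      (λ x → eval-constant (suc m) x (t ∷ z)) n p (points ws≈w v)
    where
    open Univariate (rawRing [X^ m ]) using (const; X)
    module P = RawRing (rawRing [X^ suc m ])
    points : ∀ {k} {ws : Vec (Poly m) k} {w} → Pointwise (λ x wᵢ → eval m x z ≈ wᵢ) ws w → ∀ v →
             Pointwise (λ x wᵢ → eval (suc m) x (t ∷ z) ≈ wᵢ)
               (Vec.zipWith (λ wᵢ vᵢ → const wᵢ P.+ (X P.* const (constant m vᵢ))) ws v)
               (w +[ t ] v)
    points []                         []      = []
    points {ws = x ∷ _} (x≈w ∷ ws≈w) (y ∷ v) =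
      trans (Eval.+-homo (t ∷ z) (const x) (X P.* const (constant m y)))
        (+-cong (trans (eval-const x t z) x≈w)
                (trans (Eval.*-homo (t ∷ z) X (const (constant m y)))
                  (*-cong (eval-X t z) (eval-constant (suc m) y (t ∷ z)))))
      ∷ points ws≈w v

-- Order on the reals and signs of real polynomials.

module Real {c ℓ₁ ℓ₂} (ℝ : CompleteOrderedField c ℓ₁ ℓ₂) where
  open CompleteOrderedField ℝ

  ℝ-commutativeRing : CommutativeRing c ℓ₁
  ℝ-commutativeRing = record { isCommutativeRing = isCommutativeRing }

  open CommutativeRing ℝ-commutativeRing
    using (setoid; refl; sym; trans; +-cong; +-congˡ; +-congʳ; *-cong; *-congˡ; -‿cong;
           +-identityˡ; +-identityʳ; -‿inverseʳ; zeroʳ; _-_)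
  open IsStrictTotalOrder isStrictTotalOrder public
    using (compare; irrefl; asym; <-respˡ-≈; <-respʳ-≈) renaming (trans to <-trans)
  open IntegerSolver ℝ-commutativeRing
  open SetoidReasoning setoid

  -- Makes a hypothesis a ≈ b available to the ring solver: k is the cofactor that certifies x - y
  -- as a multiple of a - b. Nested uses combine several hypotheses.
  modulo : ∀ {a b} k {x y} → a ≈ b → x ≈ y + k * (a - b) → x ≈ y
  modulo {a} {b} k {x} {y} a≈b eq = begin
    x                   ≈⟨ eq ⟩
    y + k * (a - b)     ≈⟨ +-congˡ (*-congˡ (+-congʳ a≈b)) ⟩
    y + k * (b - b)     ≈⟨ solve 3 (λ y k b → y :+ k :* (b :- b) := y) refl y k b ⟩
    y                   ∎

  x<y⇒0<y-x : ∀ {x y} → x < y → 0# < y - x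
  x<y⇒0<y-x {x} x<y = <-respˡ-≈ (-‿inverseʳ x) (+-monoˡ-< (- x) x<y)

  0<y-x⇒x<y : ∀ {x y} → 0# < y - x → x < y
  0<y-x⇒x<y {x} {y} 0<y-x =
    <-respˡ-≈ (+-identityˡ x)
      (<-respʳ-≈ (solve 2 (λ x y → y :- x :+ x := y) refl x y) (+-monoˡ-< x 0<y-x))

  0<-x⇒x<0 : ∀ {x} → 0# < - x → x < 0#
  0<-x⇒x<0 {x} = 0<y-x⇒x<y ∘ <-respʳ-≈ (sym (+-identityˡ (- x)))

  x<0⇒0<-x : ∀ {x} → x < 0# → 0# < - x
  x<0⇒0<-x {x} = <-respʳ-≈ (+-identityˡ (- x)) ∘ x<y⇒0<y-x

  +-positive : ∀ {x y} → 0# < x → 0# < y → 0# < x + y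
  +-positive {x} {y} 0<x 0<y =
    <-trans 0<y (<-respˡ-≈ (+-identityˡ y) (+-monoˡ-< y 0<x))

  *-negative : ∀ {x y} → x < 0# → y < 0# → 0# < x * y
  *-negative {x} {y} x<0 y<0 =
    <-respʳ-≈ (solve 2 (λ x y → :- x :* :- y := x :* y) refl x y)
      (*-positive (x<0⇒0<-x x<0) (x<0⇒0<-x y<0))

  *-positive-negative : ∀ {x y} → 0# < x → y < 0# → x * y < 0#
  *-positive-negative {x} {y} 0<x y<0 = 0<-x⇒x<0
    (<-respʳ-≈ (solve 2 (λ x y → x :* :- y := :- (x :* y)) refl x y) (*-positive 0<x (x<0⇒0<-x y<0)))

  ≮0-+ : ∀ {x y} → ¬ (x < 0#) → ¬ (y < 0#) → ¬ (x + y < 0#)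
  ≮0-+ {x} {y} x≮0 y≮0 x+y<0 with compare x 0#
  ... | tri< x<0 _ _ = x≮0 x<0
  ... | tri≈ _ x≈0 _ = y≮0 (<-respˡ-≈ (trans (+-congʳ x≈0) (+-identityˡ y)) x+y<0)
  ... | tri> _ _ 0<x = y≮0 (<-trans (<-respˡ-≈ (+-identityˡ y) (+-monoˡ-< y 0<x)) x+y<0)

  square-positive : ∀ {x} → ¬ (x ≈ 0#) → 0# < x * x
  square-positive {x} x≉0 with compare x 0#
  ... | tri< x<0 _ _ = *-negative x<0 x<0
  ... | tri≈ _ x≈0 _ = contradiction x≈0 x≉0
  ... | tri> _ _ 0<x = *-positive 0<x 0<x

  0<1 : 0# < 1#
  0<1 = <-respʳ-≈ (solve 0 (:1 :* :1 := :1) refl) (square-positive 1≉0)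

  -- Existence lemmas are opaque, as with-abstraction would otherwise normalise
  -- their proofs.
  opaque
    reciprocal : ∀ {x} → 0# < x → ∃[ y ] (0# < y × x * y ≈ 1#)
    reciprocal {x} 0<x with inverse x (λ x≈0 → irrefl (sym x≈0) 0<x)
    ... | y , xy≈1 with compare y 0#
    ...   | tri> _ _ 0<y = y , 0<y , xy≈1
    ...   | tri≈ _ y≈0 _ = contradiction (trans (sym xy≈1) (trans (*-congˡ y≈0) (zeroʳ x))) 1≉0
    ...   | tri< y<0 _ _ = contradiction
            (<-respˡ-≈ xy≈1 (*-positive-negative 0<x y<0))
            (asym 0<1)

  opaque
    half : ∃[ h ] (0# < h × h + h ≈ 1#)
    half with reciprocal (+-positive 0<1 0<1)
    ... | h , 0<h , 2h≈1 = h , 0<h , trans (solve 1 (λ h → h :+ h := (:1 :+ :1) :* h) refl h) 2h≈1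

  -- Near 0 from the right; this stands in for limits.
  Eventually : ∀ {p} → Pred Carrier p → Set (c ⊔ ℓ₂ ⊔ p)
  Eventually P = ∃[ ε ] (0# < ε × (∀ s → 0# < s → s < ε → P s))

  module _ {p} {P : Pred Carrier p} where

    opaque
      eventually-map : ∀ {q} {Q : Pred Carrier q} → (∀ {s} → 0# < s → P s → Q s) →
                       Eventually P → Eventually Q
      eventually-map f (ε , 0<ε , holds) = ε , 0<ε , λ s 0<s s<ε → f 0<s (holds s 0<s s<ε)

    opaque
      eventually-× : ∀ {q} {Q : Pred Carrier q} →
                     Eventually P → Eventually Q → Eventually (λ s → P s × Q s)
      eventually-× (ε , 0<ε , holds) (δ , 0<δ , holds′) with compare ε δ
      ... | tri< ε<δ _ _ = ε , 0<ε , λ s 0<s s<ε → holds s 0<s s<ε , holds′ s 0<s (<-trans s<ε ε<δ)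
      ... | tri≈ _ ε≈δ _ = ε , 0<ε , λ s 0<s s<ε → holds s 0<s s<ε , holds′ s 0<s (<-respʳ-≈ ε≈δ s<ε)
      ... | tri> _ _ δ<ε = δ , 0<δ , λ s 0<s s<δ → holds s 0<s (<-trans s<δ δ<ε) , holds′ s 0<s s<δ

    opaque
      eventually⇒∃ : Eventually P → ∃[ s ] (0# < s × P s)
      eventually⇒∃ (ε , 0<ε , holds) with half
      ... | h , 0<h , h+h≈1 = ε * h , 0<εh , holds (ε * h) 0<εh (0<y-x⇒x<y (<-respʳ-≈ εh≈ε-εh 0<εh))
        where
        0<εh : 0# < ε * h
        0<εh = *-positive 0<ε 0<h
        εh≈ε-εh : ε * h ≈ ε - ε * h
        εh≈ε-εh = modulo ε h+h≈1 (solve 2 (λ ε h →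
          ε :* h := (ε :- ε :* h) :+ ε :* (h :+ h :- :1)) refl ε h)

  eventually-< : ∀ {δ} → 0# < δ → Eventually (_< δ)
  eventually-< {δ} 0<δ = δ , 0<δ , λ _ _ s<δ → s<δ

  open Evaluation ℝ-commutativeRing using (module Eval; eval-∷; eval-X)
  open Multivariate (CommutativeRing.rawRing ℝ-commutativeRing) using (eval)
  open Univariate (CommutativeRing.rawRing ℝ-commutativeRing) using (X)
  private module ℝ[X] = Univariate (CommutativeRing.rawRing ℝ-commutativeRing)

  -- Closure of these functions under arithmetic takes the place of continuity: the coefficient list
  -- yields the sign near 0.
  IsPolynomial : (Carrier → Carrier) → Set (c ⊔ ℓ₁)
  IsPolynomial φ = ∃[ p ] (∀ s → eval 1 p (s ∷ []) ≈ φ s)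

  isPolynomial-resp : ∀ {φ ψ} → (∀ s → φ s ≈ ψ s) → IsPolynomial φ → IsPolynomial ψ
  isPolynomial-resp φ≈ψ (p , p≈φ) = p , λ s → trans (p≈φ s) (φ≈ψ s)

  isPolynomial-const : ∀ x → IsPolynomial (λ _ → x)
  isPolynomial-const x = x ∷ [] , λ s → trans (+-congˡ (zeroʳ s)) (+-identityʳ x)

  isPolynomial-id : IsPolynomial id
  isPolynomial-id = X , λ s → eval-X s []

  isPolynomial-+ : ∀ {φ ψ} → IsPolynomial φ → IsPolynomial ψ → IsPolynomial (λ s → φ s + ψ s)
  isPolynomial-+ (p , p≈φ) (q , q≈ψ) =
    ℝ[X].add p q , λ s → trans (Eval.+-homo (s ∷ []) p q) (+-cong (p≈φ s) (q≈ψ s))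

  isPolynomial-* : ∀ {φ ψ} → IsPolynomial φ → IsPolynomial ψ → IsPolynomial (λ s → φ s * ψ s)
  isPolynomial-* (p , p≈φ) (q , q≈ψ) =
    ℝ[X].mul p q , λ s → trans (Eval.*-homo (s ∷ []) p q) (*-cong (p≈φ s) (q≈ψ s))

  isPolynomial-neg : ∀ {φ} → IsPolynomial φ → IsPolynomial (λ s → - φ s)
  isPolynomial-neg (p , p≈φ) =
    map (-_) p , λ s → trans (Eval.-‿homo (s ∷ []) p) (-‿cong (p≈φ s))

  opaque
    -- One Horner step: from e < M, 0 < M and 0 < s < 1 follows s e < M, hence y + s e < y + M. The
    -- summand y is kept only when positive, so that the new bound is positive as well.
    bounded-on-unit-interval : ∀ p → ∃[ M ] (0# < M × (∀ s → 0# < s → s < 1# → eval 1 p (s ∷ []) < M))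
    bounded-on-unit-interval []      = 1# , 0<1 , λ _ _ _ → 0<1
    bounded-on-unit-interval (y ∷ p) with bounded-on-unit-interval p
    ... | M , 0<M , p<M = bound (compare y 0#)
      where
      module _ (s : Carrier) (0<s : 0# < s) (s<1 : s < 1#) where
        e = eval 1 p (s ∷ [])

        eval<y+M : eval 1 (y ∷ p) (s ∷ []) < y + M
        eval<y+M = <-respˡ-≈ (sym (eval-∷ 0 y p s [])) (0<y-x⇒x<y (<-respʳ-≈
          (solve 4 (λ y s e M → s :* (M :- e) :+ (:1 :- s) :* M := (y :+ M) :- (y :+ s :* e)) refl y s e M)
          (+-positive (*-positive 0<s (x<y⇒0<y-x (p<M s 0<s s<1))) (*-positive (x<y⇒0<y-x s<1) 0<M))))

      bound : Tri (y < 0#) (y ≈ 0#) (0# < y) →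
              ∃[ M ] (0# < M × (∀ s → 0# < s → s < 1# → eval 1 (y ∷ p) (s ∷ []) < M))
      bound (tri< y<0 _ _) = M , 0<M , λ s 0<s s<1 →
        <-trans (eval<y+M s 0<s s<1) (<-respʳ-≈ (+-identityˡ M) (+-monoˡ-< M y<0))
      bound (tri≈ _ y≈0 _) = M , 0<M , λ s 0<s s<1 →
        <-respʳ-≈ (trans (+-congʳ y≈0) (+-identityˡ M)) (eval<y+M s 0<s s<1)
      bound (tri> _ _ 0<y) = y + M , +-positive 0<y 0<M , eval<y+M

  opaque
    -- Write φ(s) = x + s p(s) with x < 0 and p < M on (0, 1). Every positive s below both 1 and -x
    -- / M works; r is 1 / M.
    eventually-negative : ∀ {φ} → IsPolynomial φ → φ 0# < 0# → Eventually (λ s → φ s < 0#)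
    eventually-negative ([]    , p≈φ) φ0<0 = contradiction φ0<0 (irrefl (sym (p≈φ 0#)))
    eventually-negative {φ} (x ∷ p , p≈φ) φ0<0
      with bounded-on-unit-interval p
    ... | M , 0<M , p<M with reciprocal 0<M
    ... | r , 0<r , Mr≈1 =
      eventually-map (λ 0<s → uncurry (negative 0<s))
        (eventually-× (eventually-< 0<1) (eventually-< (*-positive (x<0⇒0<-x x<0) 0<r)))
      where
      x<0 : x < 0#
      x<0 = <-respˡ-≈ (trans (sym (p≈φ 0#)) (trans (eval-∷ 0 x p 0# [])
        (solve 2 (λ x e → x :+ :0 :* e := x) refl x _))) φ0<0

      negative : ∀ {s} → 0# < s → s < 1# → s < - x * r → φ s < 0#
      negative {s} 0<s s<1 s<-xr =
        <-respˡ-≈ (trans (sym (eval-∷ 0 x p s [])) (p≈φ s)) (0<-x⇒x<0 (<-respʳ-≈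
          (modulo (- x) Mr≈1 (solve 5 (λ x r M s e →
            s :* (M :- e) :+ M :* ((:- x) :* r :- s) := :- (x :+ s :* e) :+ (:- x) :* (M :* r :- :1))
            refl x r M s (eval 1 p (s ∷ []))))
          (+-positive (*-positive 0<s (x<y⇒0<y-x (p<M s 0<s s<1))) (*-positive 0<M (x<y⇒0<y-x s<-xr)))))

  opaque
    eventually-positive : ∀ {φ} → IsPolynomial φ → 0# < φ 0# → Eventually (λ s → 0# < φ s)
    eventually-positive φ-poly 0<φ0 = eventually-map
      (λ _ -φ<0 → <-respʳ-≈ (solve 1 (λ x → :- :- x := x) refl _) (x<0⇒0<-x -φ<0))
      (eventually-negative (isPolynomial-neg φ-poly)
        (0<-x⇒x<0 (<-respʳ-≈ (solve 1 (λ x → x := :- :- x) refl _) 0<φ0)))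

  -- Square roots of positive reals.

  module SquareRoot {a} (0<a : 0# < a) where
    private
      0²<a : 0# * 0# < a
      0²<a = <-respˡ-≈ (sym (zeroʳ 0#)) 0<a

      square-<-reflect : ∀ {x t} → x * x < a → 0# < t → a ≤ t * t → x ≤ t
      square-<-reflect {x} {t} x²<a 0<t a≤t² with compare x t
      ... | tri< x<t _ _ = inj₁ x<t
      ... | tri≈ _ x≈t _ = inj₂ x≈t
      ... | tri> _ _ t<x = contradiction x²<a (asym (≤-<-trans a≤t² (0<y-x⇒x<y (<-respʳ-≈
        (solve 2 (λ x t → (x :- t) :* (x :- t) :+ (x :- t) :* (t :+ t) := x :* x :- t :* t) refl x t)
        (+-positive (*-positive 0<x-t 0<x-t) (*-positive 0<x-t (+-positive 0<t 0<t)))))))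
        where
        0<x-t = x<y⇒0<y-x t<x
        ≤-<-trans : ∀ {x y z} → x ≤ y → y < z → x < z
        ≤-<-trans (inj₁ x<y) = <-trans x<y
        ≤-<-trans (inj₂ x≈y) = <-respˡ-≈ (sym x≈y)

      <⇒≱ : ∀ {x y} → x < y → ¬ (y ≤ x)
      <⇒≱ x<y (inj₁ y<x) = asym x<y y<x
      <⇒≱ x<y (inj₂ y≈x) = irrefl (sym y≈x) x<y

      HasSmallSquare : Pred Carrier (c ⊔ ℓ₁ ⊔ ℓ₂)
      HasSmallSquare x = Lift (c ⊔ ℓ₁) (x * x < a)

      supremum-exists : ∃[ s ] (UpperBound HasSmallSquare s × (∀ u → UpperBound HasSmallSquare u → s ≤ u))
      -- The bound a + 1 works because (a + 1)² - a = a² + a + 1 > 0.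
      supremum-exists = supremum HasSmallSquare (0# , lift 0²<a) (a + 1# , λ x x²<a →
        square-<-reflect (lower x²<a) (+-positive 0<a 0<1) (inj₁ (0<y-x⇒x<y (<-respʳ-≈
          (solve 1 (λ a → a :* a :+ (a :+ :1) := (a :+ :1) :* (a :+ :1) :- a) refl a)
          (+-positive (*-positive 0<a 0<a) (+-positive 0<a 0<1))))))

      module _ (s : Carrier) (s-upper : UpperBound HasSmallSquare s) where

        a≤s²⇒0<s : a ≤ s * s → 0# < s
        a≤s²⇒0<s a≤s² with s-upper 0# (lift 0²<a)
        ... | inj₁ 0<s = 0<s
        ... | inj₂ 0≈s = contradiction a≤s²
              (<⇒≱ (<-respˡ-≈ (trans (sym (zeroʳ s)) (*-congˡ 0≈s)) 0<a))

        -- If s² < a, then a - (s + δ)² is positive at δ = 0, hence for some δ > 0. So s + δ belongs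
        -- to the set and exceeds its upper bound s.
        s²≮a : ¬ (s * s < a)
        s²≮a s²<a = exceeds (eventually⇒∃ (eventually-positive
          (isPolynomial-+ (isPolynomial-const a) (isPolynomial-neg (isPolynomial-* s+ s+)))
          (<-respʳ-≈ (solve 2 (λ s a → a :- s :* s := a :- (s :+ :0) :* (s :+ :0)) refl s a)
            (x<y⇒0<y-x s²<a))))
          where
          s+ = isPolynomial-+ (isPolynomial-const s) isPolynomial-id
          exceeds : ¬ (∃[ δ ] (0# < δ × 0# < a - (s + δ) * (s + δ)))
          exceeds (δ , 0<δ , 0<a-[s+δ]²) = <⇒≱
            (0<y-x⇒x<y (<-respʳ-≈ (solve 2 (λ s δ → δ := s :+ δ :- s) refl s δ) 0<δ))
            (s-upper (s + δ) (lift (0<y-x⇒x<y 0<a-[s+δ]²)))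

        -- Dually, some s - δ with δ > 0 is still an upper bound. It must also be kept positive, as
        -- a large square bounds the members of the set only by a positive number.
        a≮s² : (∀ u → UpperBound HasSmallSquare u → s ≤ u) → ¬ (a < s * s)
        a≮s² s-least a<s² = undercuts (eventually⇒∃ (eventually-×
          (eventually-positive (isPolynomial-+ (isPolynomial-* s- s-) (isPolynomial-const (- a)))
            (<-respʳ-≈ (solve 2 (λ s a → s :* s :- a := (s :- :0) :* (s :- :0) :- a) refl s a)
              (x<y⇒0<y-x a<s²)))
          (eventually-positive s-
            (<-respʳ-≈ (solve 1 (λ s → s := s :- :0) refl s) (a≤s²⇒0<s (inj₁ a<s²))))))
          where
          s- = isPolynomial-+ (isPolynomial-const s) (isPolynomial-neg isPolynomial-id)
          undercuts : ¬ (∃[ δ ] (0# < δ × 0# < (s - δ) * (s - δ) - a × 0# < s - δ))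
          undercuts (δ , 0<δ , 0<[s-δ]²-a , 0<s-δ) = <⇒≱
            (0<y-x⇒x<y (<-respʳ-≈ (solve 2 (λ s δ → δ := s :- (s :- δ)) refl s δ) 0<δ))
            (s-least (s - δ) λ x x²<a →
              square-<-reflect (lower x²<a) 0<s-δ (inj₁ (0<y-x⇒x<y 0<[s-δ]²-a)))

    opaque
      square-root : ∃[ r ] (0# < r × r * r ≈ a)
      square-root = equality supremum-exists
        where
        equality : ∃[ s ] (UpperBound HasSmallSquare s × (∀ u → UpperBound HasSmallSquare u → s ≤ u)) →
                   ∃[ r ] (0# < r × r * r ≈ a)
        equality (s , s-upper , s-least) with compare (s * s) a
        ... | tri< s²<a _ _ = contradiction s²<a (s²≮a s s-upper)
        ... | tri≈ _ s²≈a _ = s , a≤s²⇒0<s s s-upper (inj₂ (sym s²≈a)) , s²≈a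
        ... | tri> _ _ a<s² = contradiction a<s² (a≮s² s s-upper s-least)

  open SquareRoot public using (square-root)

-- Complex arithmetic and the sign of Im (z / w).

module ComplexPlane {c ℓ₁ ℓ₂} (ℝ : CompleteOrderedField c ℓ₁ ℓ₂) where
  open CompleteOrderedField ℝ
  open Complex ℝ
  open Real ℝ
  open IsStrictTotalOrder isStrictTotalOrder using (_≟_)
  private
    module R = CommutativeRing ℝ-commutativeRing
  open R using (_-_)
  open IntegerSolver ℝ-commutativeRing

  ℂ-commutativeRing : CommutativeRing c ℓ₁
  ℂ-commutativeRing = record
    { RawRing ℂ-rawRing
    ; isCommutativeRing = record
      { isRing = record
        { +-isAbelianGroup = record
          { isGroup = record
            { isMonoid = record
              { isSemigroup = record
                { isMagma = record
                  { isEquivalence = record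
                    { refl  = R.refl , R.refl
                    ; sym   = λ (p , q) → R.sym p , R.sym q
                    ; trans = λ (p , q) (p′ , q′) → R.trans p p′ , R.trans q q′
                    }
                  ; ∙-cong = λ (p , q) (p′ , q′) → R.+-cong p p′ , R.+-cong q q′
                  }
                ; assoc = λ x y z → R.+-assoc _ _ _ , R.+-assoc _ _ _
                }
              ; identity = (λ x → R.+-identityˡ _ , R.+-identityˡ _)
                         , (λ x → R.+-identityʳ _ , R.+-identityʳ _)
              }
            ; inverse = (λ x → R.-‿inverseˡ _ , R.-‿inverseˡ _)
                      , (λ x → R.-‿inverseʳ _ , R.-‿inverseʳ _)
            ; ⁻¹-cong = λ (p , q) → R.-‿cong p , R.-‿cong q
            }
          ; comm = λ x y → R.+-comm _ _ , R.+-comm _ _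
          }
        ; *-cong = λ (p , q) (p′ , q′) →
            R.+-cong (R.*-cong p p′) (R.-‿cong (R.*-cong q q′)) ,
            R.+-cong (R.*-cong p q′) (R.*-cong q p′)
        ; *-assoc = λ (a +i b) (a′ +i b′) (a″ +i b″) →
            solve 6 (λ a b a′ b′ a″ b″ →
              (a :* a′ :- b :* b′) :* a″ :- (a :* b′ :+ b :* a′) :* b″
              := a :* (a′ :* a″ :- b′ :* b″) :- b :* (a′ :* b″ :+ b′ :* a″)) R.refl a b a′ b′ a″ b″ ,
            solve 6 (λ a b a′ b′ a″ b″ →
              (a :* a′ :- b :* b′) :* b″ :+ (a :* b′ :+ b :* a′) :* a″
              := a :* (a′ :* b″ :+ b′ :* a″) :+ b :* (a′ :* a″ :- b′ :* b″)) R.refl a b a′ b′ a″ b″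
        ; *-identity =
            (λ (a +i b) → solve 2 (λ a b → :1 :* a :- :0 :* b := a) R.refl a b ,
                          solve 2 (λ a b → :1 :* b :+ :0 :* a := b) R.refl a b) ,
            (λ (a +i b) → solve 2 (λ a b → a :* :1 :- b :* :0 := a) R.refl a b ,
                          solve 2 (λ a b → a :* :0 :+ b :* :1 := b) R.refl a b)
        ; distrib =
            (λ (a +i b) (a′ +i b′) (a″ +i b″) →
              solve 6 (λ a b a′ b′ a″ b″ →
                a :* (a′ :+ a″) :- b :* (b′ :+ b″)
                := (a :* a′ :- b :* b′) :+ (a :* a″ :- b :* b″)) R.refl a b a′ b′ a″ b″ ,
              solve 6 (λ a b a′ b′ a″ b″ →
                a :* (b′ :+ b″) :+ b :* (a′ :+ a″)
                := (a :* b′ :+ b :* a′) :+ (a :* b″ :+ b :* a″)) R.refl a b a′ b′ a″ b″) ,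
            (λ (a +i b) (a′ +i b′) (a″ +i b″) →
              solve 6 (λ a b a′ b′ a″ b″ →
                (a′ :+ a″) :* a :- (b′ :+ b″) :* b
                := (a′ :* a :- b′ :* b) :+ (a″ :* a :- b″ :* b)) R.refl a b a′ b′ a″ b″ ,
              solve 6 (λ a b a′ b′ a″ b″ →
                (a′ :+ a″) :* b :+ (b′ :+ b″) :* a
                := (a′ :* b :+ b′ :* a) :+ (a″ :* b :+ b″ :* a)) R.refl a b a′ b′ a″ b″)
        }
      ; *-comm = λ (a +i b) (a′ +i b′) →
          solve 4 (λ a b a′ b′ → a :* a′ :- b :* b′ := a′ :* a :- b′ :* b) R.refl a b a′ b′ ,
          solve 4 (λ a b a′ b′ → a :* b′ :+ b :* a′ := a′ :* b :+ b′ :* a) R.refl a b a′ b′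
      }
    }

  module C = CommutativeRing ℂ-commutativeRing
  open Exponentiation C.commutativeSemiring using (_^_; ^-congˡ; ^-distrib-*; ^-homo-*)

  normSq : ℂ → Carrier
  normSq z = re z * re z + im z * im z

  normSq-cong : ∀ {z w} → z C.≈ w → normSq z ≈ normSq w
  normSq-cong (p , q) = R.+-cong (R.*-cong p p) (R.*-cong q q)

  normSq-* : ∀ z w → normSq (z C.* w) ≈ normSq z * normSq w
  normSq-* (a +i b) (a′ +i b′) = solve 4 (λ a b a′ b′ →
    (a :* a′ :- b :* b′) :* (a :* a′ :- b :* b′) :+ (a :* b′ :+ b :* a′) :* (a :* b′ :+ b :* a′)
    := (a :* a :+ b :* b) :* (a′ :* a′ :+ b′ :* b′)) R.refl a b a′ b′

  0<normSq : ∀ {z} → ¬ (z C.≈ C.0#) → 0# < normSq z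
  0<normSq {a +i b} z≉0 with a ≟ 0# | b ≟ 0#
  ... | yes a≈0 | yes b≈0 = contradiction (a≈0 , b≈0) z≉0
  ... | no  a≉0 | no  b≉0 = +-positive (square-positive a≉0) (square-positive b≉0)
  ... | yes a≈0 | no  b≉0 = <-respʳ-≈ (modulo (- a) a≈0 (solve 2 (λ a b →
    b :* b := (a :* a :+ b :* b) :+ (:- a) :* (a :- :0)) R.refl a b)) (square-positive b≉0)
  ... | no  a≉0 | yes b≈0 = <-respʳ-≈ (modulo (- b) b≈0 (solve 2 (λ a b →
    a :* a := (a :* a :+ b :* b) :+ (:- b) :* (b :- :0)) R.refl a b)) (square-positive a≉0)

  0<normSq⇒≉0 : ∀ {z} → 0# < normSq z → ¬ (z C.≈ C.0#)
  0<normSq⇒≉0 0<N z≈0 = irrefl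
    (R.sym (R.trans (normSq-cong z≈0) (solve 0 (:0 :* :0 :+ :0 :* :0 := :0) R.refl))) 0<N

  -- |z|² is multiplicative, and positive exactly off zero.
  *-≉0 : ∀ {z w} → ¬ (z C.≈ C.0#) → ¬ (w C.≈ C.0#) → ¬ (z C.* w C.≈ C.0#)
  *-≉0 {z} {w} z≉0 w≉0 = 0<normSq⇒≉0
    (<-respʳ-≈ (R.sym (normSq-* z w)) (*-positive (0<normSq z≉0) (0<normSq w≉0)))

  fromℝ-* : ∀ x y → fromℝ x C.* fromℝ y C.≈ fromℝ (x * y)
  fromℝ-* x y = solve 2 (λ x y → x :* y :- :0 :* :0 := x :* y) R.refl x y ,
                solve 2 (λ x y → x :* :0 :+ :0 :* y := :0) R.refl x y

  conj : ℂ → ℂ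
  conj z = re z +i - im z

  conj-≉0 : ∀ {z} → ¬ (z C.≈ C.0#) → ¬ (conj z C.≈ C.0#)
  conj-≉0 {a +i b} z≉0 (a≈0 , -b≈0) = z≉0 (a≈0 , modulo (- 1#) -b≈0
    (solve 1 (λ b → b := :0 :+ (:- :1) :* (:- b :- :0)) R.refl b))

  -- |w|² Im (z / w).
  cross : ℂ → ℂ → Carrier
  cross z w = im z * re w - re z * im w

  cross-cong : ∀ {z z′ w w′} → z C.≈ z′ → w C.≈ w′ → cross z w ≈ cross z′ w′
  cross-cong (p , q) (p′ , q′) = R.+-cong (R.*-cong q p′) (R.-‿cong (R.*-cong p q′))

  im-*-conj : ∀ z w → im (z C.* conj w) ≈ cross z w
  im-*-conj (a +i b) (a′ +i b′) =
    solve 4 (λ a b a′ b′ → a :* (:- b′) :+ b :* a′ := b :* a′ :- a :* b′) R.refl a b a′ b′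

  -- The map u ↦ -1 / u preserves the sign of the imaginary part; here u = w / z.
  cross-neg : ∀ z w → cross (C.- z) w ≈ cross w z
  cross-neg (a +i b) (a′ +i b′) = solve 4 (λ a b a′ b′ →
    (:- b) :* a′ :- (:- a) :* b′ := b′ :* a :- a′ :* b) R.refl a b a′ b′

  -- Im ((x − z) / y) = Im (x / y) − Im (z / y).
  cross-minus : ∀ x y z → ¬ (cross x y < 0#) → ¬ (cross y z < 0#) → ¬ (cross (x C.- z) y < 0#)
  cross-minus (a +i b) (a′ +i b′) (a″ +i b″) xy≮0 yz≮0 =
    ≮0-+ xy≮0 yz≮0 ∘ <-respˡ-≈ (solve 6 (λ a b a′ b′ a″ b″ →
      (b :- b″) :* a′ :- (a :- a″) :* b′
      := (b :* a′ :- a :* b′) :+ (b′ :* a″ :- a′ :* b″)) R.refl a b a′ b′ a″ b″)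

  InUpperHalfPlane : ℂ → Set ℓ₂
  InUpperHalfPlane z = 0# < im z

  shift-in-upper-half-plane : ∀ {z t y} → InUpperHalfPlane t → InUpperHalfPlane z → 0# ≤ y →
                              InUpperHalfPlane (z C.+ t C.* fromℝ y)
  shift-in-upper-half-plane {z} {t} {y} 0<t 0<z (inj₁ 0<y) = <-respʳ-≈
    (solve 4 (λ a b x y → x :+ b :* y := x :+ (a :* :0 :+ b :* y)) R.refl (re t) (im t) (im z) y)
    (+-positive 0<z (*-positive 0<t 0<y))
  shift-in-upper-half-plane {z} {t} {y} 0<t 0<z (inj₂ 0≈y) = <-respʳ-≈
    (modulo (im t) 0≈y (solve 4 (λ a b x y →
      x := (x :+ (a :* :0 :+ b :* y)) :+ b :* (:0 :- y)) R.refl (re t) (im t) (im z) y)) 0<z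

  cross-scale : ∀ r z w → cross (fromℝ r C.* z) w ≈ r * cross z w
  cross-scale r (a +i b) (a′ +i b′) = solve 5 (λ r a b a′ b′ →
    (r :* b :+ :0 :* a) :* a′ :- (r :* a :- :0 :* b) :* b′ := r :* (b :* a′ :- a :* b′))
    R.refl r a b a′ b′

  opaque
    -- The root is y = -z / w, written as -z `conj w` / |w|² with r = 1 / |w|². Its imaginary part
    -- is -`cross z w` / |w|².
    cross<0⇒root : ∀ z w → cross z w < 0# → ∃[ y ] (0# < im y × z C.+ y C.* w C.≈ C.0#)
    cross<0⇒root (a +i b) (a′ +i b′) cross<0 with reciprocal (0<normSq w≉0)
      where
      w≉0 : ¬ ((a′ +i b′) C.≈ C.0#)
      w≉0 (a′≈0 , b′≈0) = irrefl
        (modulo b a′≈0 (modulo (- a) b′≈0 (solve 4 (λ a b a′ b′ →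
          b :* a′ :- a :* b′ := (:0 :+ b :* (a′ :- :0)) :+ (:- a) :* (b′ :- :0)) R.refl a b a′ b′)))
        cross<0
    ... | r , 0<r , Nr≈1 = (- ((a * a′ + b * b′) * r) +i (- (b * a′ - a * b′) * r)) ,
      *-positive (x<0⇒0<-x cross<0) 0<r ,
      modulo (- a) Nr≈1 (solve 5 (λ a b a′ b′ r →
        a :+ ((:- ((a :* a′ :+ b :* b′) :* r)) :* a′ :- ((:- (b :* a′ :- a :* b′)) :* r) :* b′)
        := :0 :+ (:- a) :* ((a′ :* a′ :+ b′ :* b′) :* r :- :1)) R.refl a b a′ b′ r) ,
      modulo (- b) Nr≈1 (solve 5 (λ a b a′ b′ r →
        b :+ ((:- ((a :* a′ :+ b :* b′) :* r)) :* b′ :+ ((:- (b :* a′ :- a :* b′)) :* r) :* a′)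
        := :0 :+ (:- b) :* ((a′ :* a′ :+ b′ :* b′) :* r :- :1)) R.refl a b a′ b′ r)

  -- Roots of ± 𝕚 and rotation into the lower half-plane.

  𝕚 : ℂ
  𝕚 = 0# +i 1#

  IsPlusMinus : ℂ → ℂ → Set ℓ₁
  IsPlusMinus w z = z C.≈ w ⊎ z C.≈ C.- w

  -- With z = p + iq, the half-angle formulas give the root x + iq/(2x), where
  -- x = √((1 + p)/2). Here p ≥ 0 ensures x > 0, and it persists to the root.
  opaque
    unit-square-root : ∀ {z} → normSq z ≈ 1# → ¬ (re z < 0#) →
                       ∃[ w ] (normSq w ≈ 1# × ¬ (re w < 0#) × w C.* w C.≈ z)
    unit-square-root {p +i q} N≈1 p≮0 =
      let h , 0<h , h+h≈1 = half
          x , 0<x , x²≈   = square-root (*-positive 0<1+p 0<h)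
          y , 0<y , xy≈1  = reciprocal 0<x
          -- Here h = 1/2 and y = 1/x. From q² = (1 - p)(1 + p) and x² = (1 + p)/2 follows (q/(2x))²
          -- = (1 - p)/2.
          im²≈ : (q * h * y) * (q * h * y) ≈ (1# - p) * h
          im²≈ = modulo (h * h * (y * y)) N≈1 (modulo ((p - 1#) * h * (y * y)) x²≈
            (modulo ((1# - p) * h * (x * y + 1#)) xy≈1
            (solve 5 (λ p q h x y →
              (q :* h :* y) :* (q :* h :* y)
              := (((:1 :- p) :* h
                 :+ (h :* h :* (y :* y)) :* ((p :* p :+ q :* q) :- :1))
                 :+ ((p :- :1) :* h :* (y :* y)) :* (x :* x :- (:1 :+ p) :* h))
                 :+ ((:1 :- p) :* h :* (x :* y :+ :1)) :* (x :* y :- :1))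
              R.refl p q h x y)))
      in (x +i (q * h * y)) ,
         R.trans (R.+-cong x²≈ im²≈) (modulo 1# h+h≈1 (solve 2 (λ p h →
           (:1 :+ p) :* h :+ (:1 :- p) :* h := :1 :+ :1 :* (h :+ h :- :1)) R.refl p h)) ,
         asym 0<x ,
         R.trans (R.+-cong x²≈ (R.-‿cong im²≈)) (modulo p h+h≈1 (solve 2 (λ p h →
           (:1 :+ p) :* h :- (:1 :- p) :* h := p :+ p :* (h :+ h :- :1)) R.refl p h)) ,
         modulo q h+h≈1 (modulo (q * (h + h)) xy≈1 (solve 4 (λ q h x y →
           x :* (q :* h :* y) :+ (q :* h :* y) :* x
           := (q :+ q :* (h :+ h :- :1)) :+ (q :* (h :+ h)) :* (x :* y :- :1)) R.refl q h x y))
      where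
      0<1+p : 0# < 1# + p
      0<1+p with compare p 0#
      ... | tri< p<0 _ _ = contradiction p<0 p≮0
      ... | tri≈ _ p≈0 _ = <-respʳ-≈ (modulo (- 1#) p≈0
            (solve 1 (λ p → :1 := (:1 :+ p) :+ (:- :1) :* (p :- :0)) R.refl p)) 0<1
      ... | tri> _ _ 0<p = +-positive 0<1 0<p

  even⊎odd : ∀ n → ∃[ j ] (n ≡ j ℕ.+ j ⊎ n ≡ suc (j ℕ.+ j))
  even⊎odd zero    = 0 , inj₁ ≡.refl
  even⊎odd (suc n) with even⊎odd n
  ... | j , inj₁ n≡2j   = j , inj₂ (≡.cong suc n≡2j)
  ... | j , inj₂ n≡2j+1 = suc j , inj₁ (≡.trans (≡.cong suc n≡2j+1) (≡.cong suc (≡.sym (ℕ.+-suc j j))))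

  𝕚*𝕚* : ∀ z → 𝕚 C.* (𝕚 C.* z) C.≈ C.- z
  𝕚*𝕚* (a +i b) =
    solve 2 (λ a b → :0 :* (:0 :* a :- :1 :* b) :- :1 :* (:0 :* b :+ :1 :* a) := :- a) R.refl a b ,
    solve 2 (λ a b → :0 :* (:0 :* b :+ :1 :* a) :+ :1 :* (:0 :* a :- :1 :* b) := :- b) R.refl a b

  neg-neg-𝕚 : C.- (C.- 𝕚) C.≈ 𝕚
  neg-neg-𝕚 = solve 0 (:- (:- :0) := :0) R.refl , solve 0 (:- (:- :1) := :1) R.refl

  𝕚^odd : ∀ j → IsPlusMinus 𝕚 (𝕚 ^ suc (j ℕ.+ j))
  𝕚^odd zero    = inj₁ (C.*-identityʳ 𝕚)
  𝕚^odd (suc j) rewrite ℕ.+-suc j j with 𝕚^odd j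
  ... | inj₁ eq = inj₂ (C.trans (𝕚*𝕚* _) (C.-‿cong eq))
  ... | inj₂ eq = inj₁ (C.trans (𝕚*𝕚* _) (C.trans (C.-‿cong eq) neg-neg-𝕚))

  Root : ℕ → ℂ → Set (c ⊔ ℓ₁)
  Root k θ = ∃[ ω ] (ω ^ k C.≈ θ)

  -- The norm and sign conditions are those of `unit-square-root`, so that square roots can be taken
  -- repeatedly. The sign of 𝕚 is left open because odd powers of 𝕚 take both values.
  HasUnitRoot : ℕ → Set (c ⊔ ℓ₁ ⊔ ℓ₂)
  HasUnitRoot k = ∃[ ω ] (normSq ω ≈ 1# × ¬ (re ω < 0#) × IsPlusMinus 𝕚 (ω ^ k))

  hasUnitRoot-double : ∀ j → HasUnitRoot j → HasUnitRoot (j ℕ.+ j)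
  hasUnitRoot-double j (ω , N≈1 , re≮0 , ω^j≈±𝕚) = take-root (unit-square-root N≈1 re≮0)
    where
    take-root : ∃[ w ] (normSq w ≈ 1# × ¬ (re w < 0#) × w C.* w C.≈ ω) → HasUnitRoot (j ℕ.+ j)
    take-root (w , N′≈1 , re′≮0 , w²≈ω) = w , N′≈1 , re′≮0 , resp ω^j≈±𝕚
      where
      w^2j≈ω^j : w ^ (j ℕ.+ j) C.≈ ω ^ j
      w^2j≈ω^j = C.trans (^-homo-* w j j) (C.trans (C.sym (^-distrib-* w w j)) (^-congˡ j w²≈ω))

      resp : IsPlusMinus 𝕚 (ω ^ j) → IsPlusMinus 𝕚 (w ^ (j ℕ.+ j))
      resp (inj₁ eq) = inj₁ (C.trans w^2j≈ω^j eq)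
      resp (inj₂ eq) = inj₂ (C.trans w^2j≈ω^j eq)

  -- For k = 2ᵃ m with m odd, a 2ᵃ-th root ω of 𝕚 satisfies ω ^ k = 𝕚 ^ m = ± 𝕚.
  opaque
    hasUnitRoot : ∀ k → 0 ℕ.< k → HasUnitRoot k
    hasUnitRoot = <-rec _ (λ k rec 0<k → step k rec 0<k (even⊎odd k))
      where
      step : ∀ k → (∀ {j} → j ℕ.< k → 0 ℕ.< j → HasUnitRoot j) → 0 ℕ.< k →
             ∃[ j ] (k ≡ j ℕ.+ j ⊎ k ≡ suc (j ℕ.+ j)) → HasUnitRoot k
      step k rec 0<k (j     , inj₂ ≡.refl) =
        𝕚 , solve 0 (:0 :* :0 :+ :1 :* :1 := :1) R.refl , irrefl R.refl , 𝕚^odd j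
      step k rec 0<k (suc j , inj₁ ≡.refl) =
        hasUnitRoot-double (suc j) (rec (ℕ.m<m+n (suc j) ℕ.z<s) ℕ.z<s)

  root-* : ∀ k {θ η} → Root k θ → Root k η → Root k (θ C.* η)
  root-* k (ω , ω^k≈θ) (ζ , ζ^k≈η) = ω C.* ζ , C.trans (^-distrib-* ω ζ k) (C.*-cong ω^k≈θ ζ^k≈η)

  root-resp : ∀ k {θ η} → θ C.≈ η → Root k θ → Root k η
  root-resp k θ≈η (ω , ω^k≈θ) = ω , C.trans ω^k≈θ θ≈η

  opaque
    -- From k-th roots of 𝕚 and -𝕚, products give k-th roots of 1 and -1. Since z ≠ 0, one of z, -z,
    -- 𝕚 z, -𝕚 z has negative imaginary part.
    direction-into-lower-half-plane : ∀ k {z} → 0 ℕ.< k → ¬ (z C.≈ C.0#) → ∃[ ω ] (im (ω ^ k C.* z) < 0#)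
    direction-into-lower-half-plane k {z@(a +i b)} 0<k z≉0 =
      choose (hasUnitRoot k 0<k)
      where
      via : ∀ {θ} → Root k θ → im (θ C.* z) < 0# → ∃[ ω ] (im (ω ^ k C.* z) < 0#)
      via (ω , ω^k≈θ) = λ im<0 → ω , <-respˡ-≈ (R.sym (proj₂ (C.*-congʳ {z} ω^k≈θ))) im<0

      cases : Root k 𝕚 → Root k (C.- 𝕚) → ∃[ ω ] (im (ω ^ k C.* z) < 0#)
      cases √𝕚 √-𝕚 with compare b 0# | compare a 0#
      ... | tri< b<0 _ _ | _ = via (root-* k √𝕚 √-𝕚)
            (<-respˡ-≈ (solve 2 (λ a b →
              b := (:0 :* (:- :0) :- :1 :* (:- :1)) :* b :+ (:0 :* (:- :1) :+ :1 :* (:- :0)) :* a)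
              R.refl a b) b<0)
      ... | tri> _ _ 0<b | _ = via (root-* k √𝕚 √𝕚)
            (0<-x⇒x<0 (<-respʳ-≈ (solve 2 (λ a b →
              b := :- ((:0 :* :0 :- :1 :* :1) :* b :+ (:0 :* :1 :+ :1 :* :0) :* a))
              R.refl a b) 0<b))
      ... | tri≈ _ b≈0 _ | tri< a<0 _ _ = via √𝕚
            (<-respˡ-≈ (solve 2 (λ a b → a := :0 :* b :+ :1 :* a) R.refl a b) a<0)
      ... | tri≈ _ b≈0 _ | tri> _ _ 0<a = via √-𝕚
            (0<-x⇒x<0 (<-respʳ-≈ (solve 2 (λ a b →
              a := :- ((:- :0) :* b :+ (:- :1) :* a)) R.refl a b) 0<a))
      ... | tri≈ _ b≈0 _ | tri≈ _ a≈0 _ = contradiction (a≈0 , b≈0) z≉0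

      -- Cubing exchanges 𝕚 and -𝕚, so a k-th root of either one gives a k-th root of the other.
      cube : ∀ {θ η} → θ C.* (θ C.* θ) C.≈ η → Root k θ → Root k η
      cube θ³≈η √θ = root-resp k θ³≈η (root-* k √θ (root-* k √θ √θ))

      choose : HasUnitRoot k → ∃[ ω ] (im (ω ^ k C.* z) < 0#)
      choose (ω , _ , _ , inj₁ ω^k≈𝕚)  = cases (ω , ω^k≈𝕚) (cube (𝕚*𝕚* 𝕚) (ω , ω^k≈𝕚))
      choose (ω , _ , _ , inj₂ ω^k≈-𝕚) = cases (cube [-𝕚]³≈𝕚 (ω , ω^k≈-𝕚)) (ω , ω^k≈-𝕚)
        where
        [-𝕚]³≈𝕚 : C.- 𝕚 C.* (C.- 𝕚 C.* C.- 𝕚) C.≈ 𝕚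
        [-𝕚]³≈𝕚 =
          solve 0 (:- :0 :* (:- :0 :* :- :0 :- :- :1 :* :- :1) :- :- :1 :* (:- :0 :* :- :1 :+ :- :1 :* :- :0)
                   := :0) R.refl ,
          solve 0 (:- :0 :* (:- :0 :* :- :1 :+ :- :1 :* :- :0) :+ :- :1 :* (:- :0 :* :- :0 :- :- :1 :* :- :1)
                   := :1) R.refl

-- Univariate complex polynomials near 0.

module ComplexPolynomials {c ℓ₁ ℓ₂} (ℝ : CompleteOrderedField c ℓ₁ ℓ₂) where
  private module ℝ = CompleteOrderedField ℝ
  open Complex ℝ
  open Real ℝ
  open ComplexPlane ℝ
  open CommutativeRing ℂ-commutativeRing
    using (_≈_; _+_; _*_; 0#; setoid; refl; sym; trans; +-cong; *-congˡ; *-congʳ; zeroˡ;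
           commutativeSemiring)
  open CommutativeRing ℝ-commutativeRing using () renaming (sym to ℝ-sym; trans to ℝ-trans)
  open Exponentiation commutativeSemiring using (_^_; ^-distrib-*)
  open IntegerSolver ℂ-commutativeRing
  open Evaluation ℂ-commutativeRing
  open Univariate ℂ-rawRing using (coeff)
  open SetoidReasoning setoid

  _⟨_⟩ : Poly 1 → ℂ → ℂ
  P ⟨ t ⟩ = eval 1 P (t ∷ [])

  -- For such functions of a real variable, `normSq` and `cross` are real polynomials, to which the
  -- sign lemmas apply.
  IsPolynomialᶜ : (ℝ.Carrier → ℂ) → Set (c ⊔ ℓ₁)
  IsPolynomialᶜ φ = IsPolynomial (re ∘ φ) × IsPolynomial (im ∘ φ)

  isPolynomialᶜ-const : ∀ z → IsPolynomialᶜ (λ _ → z)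
  isPolynomialᶜ-const z = isPolynomial-const (re z) , isPolynomial-const (im z)

  isPolynomialᶜ-fromℝ : IsPolynomialᶜ fromℝ
  isPolynomialᶜ-fromℝ = isPolynomial-id , isPolynomial-const ℝ.0#

  isPolynomialᶜ-+ : ∀ {φ ψ} → IsPolynomialᶜ φ → IsPolynomialᶜ ψ → IsPolynomialᶜ (λ s → φ s + ψ s)
  isPolynomialᶜ-+ (φ-re , φ-im) (ψ-re , ψ-im) = isPolynomial-+ φ-re ψ-re , isPolynomial-+ φ-im ψ-im

  isPolynomialᶜ-* : ∀ {φ ψ} → IsPolynomialᶜ φ → IsPolynomialᶜ ψ → IsPolynomialᶜ (λ s → φ s * ψ s)
  isPolynomialᶜ-* (φ-re , φ-im) (ψ-re , ψ-im) =
    isPolynomial-+ (isPolynomial-* φ-re ψ-re) (isPolynomial-neg (isPolynomial-* φ-im ψ-im)) ,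
    isPolynomial-+ (isPolynomial-* φ-re ψ-im) (isPolynomial-* φ-im ψ-re)

  isPolynomialᶜ-⟨⟩ : ∀ {φ} P → IsPolynomialᶜ φ → IsPolynomialᶜ (λ s → P ⟨ φ s ⟩)
  isPolynomialᶜ-⟨⟩     []      _      = isPolynomialᶜ-const 0#
  isPolynomialᶜ-⟨⟩ {φ} (x ∷ P) φ-poly = resp
    (isPolynomialᶜ-+ (isPolynomialᶜ-const x) (isPolynomialᶜ-* φ-poly (isPolynomialᶜ-⟨⟩ P φ-poly)))
    where
    resp : IsPolynomialᶜ (λ s → x + φ s * P ⟨ φ s ⟩) → IsPolynomialᶜ (λ s → (x ∷ P) ⟨ φ s ⟩)
    resp (p , q) = isPolynomial-resp (λ s → ℝ-sym (proj₁ (eval-∷ 0 x P (φ s) []))) p ,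
                   isPolynomial-resp (λ s → ℝ-sym (proj₂ (eval-∷ 0 x P (φ s) []))) q

  isPolynomial-normSq : ∀ {φ} → IsPolynomialᶜ φ → IsPolynomial (λ s → normSq (φ s))
  isPolynomial-normSq (φ-re , φ-im) = isPolynomial-+ (isPolynomial-* φ-re φ-re) (isPolynomial-* φ-im φ-im)

  isPolynomial-cross : ∀ {φ ψ} → IsPolynomialᶜ φ → IsPolynomialᶜ ψ → IsPolynomial (λ s → cross (φ s) (ψ s))
  isPolynomial-cross (φ-re , φ-im) (ψ-re , ψ-im) =
    isPolynomial-+ (isPolynomial-* φ-im ψ-re) (isPolynomial-neg (isPolynomial-* φ-re ψ-im))

  -- Here k is the order of vanishing at 0 and a is the lowest nonzero coefficient.
  HasLowestTerm : Poly 1 → Set (c ⊔ ℓ₁)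
  HasLowestTerm P = ∃[ k ] ∃[ a ] ∃[ Q ] (¬ (a ≈ 0#) × (∀ t → P ⟨ t ⟩ ≈ t ^ k * (a + t * Q ⟨ t ⟩)))

  opaque
    lowestTerm : ∀ P → (∀ k → coeff P k ≈ 0#) ⊎ HasLowestTerm P
    lowestTerm []      = inj₁ λ _ → refl
    lowestTerm (x ∷ P) with x ≟ᶜ 0# | lowestTerm P
    ... | no x≉0  | _         = inj₂ (0 , x , P , x≉0 , λ t → trans (eval-∷ 0 x P t [])
          (solve 2 (λ x e → x :+ e := :1 :* (x :+ e)) refl x (t * P ⟨ t ⟩)))
    ... | yes x≈0 | inj₁ P≈0 = inj₁ λ { zero → x≈0 ; (suc k) → P≈0 k }
    ... | yes x≈0 | inj₂ (k , a , Q , a≉0 , P≈) = inj₂ (suc k , a , Q , a≉0 , λ t → begin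
      (x ∷ P) ⟨ t ⟩                           ≈⟨ eval-∷ 0 x P t [] ⟩
      x + t * P ⟨ t ⟩                         ≈⟨ +-cong x≈0 (*-congˡ (P≈ t)) ⟩
      0# + t * (t ^ k * (a + t * Q ⟨ t ⟩))    ≈⟨ solve 3 (λ t p e →
        :0 :+ t :* (p :* e) := (t :* p) :* e) refl t (t ^ k) (a + t * Q ⟨ t ⟩) ⟩
      t ^ suc k * (a + t * Q ⟨ t ⟩)           ∎)

  ^-≉0 : ∀ {t} k → ¬ (t ≈ 0#) → ¬ (t ^ k ≈ 0#)
  ^-≉0 zero    t≉0 = ℝ.1≉0 ∘ proj₁
  ^-≉0 (suc k) t≉0 = *-≉0 t≉0 (^-≉0 k t≉0)

  opaque
    -- In P(s) = sᵏ (a + s Q(s)) the power is nonzero for s > 0, and |a + s Q(s)|² is a real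
    -- polynomial in s with value |a|² > 0 at 0. This replaces the finiteness of the set of roots.
    zero⊎eventually-nonzero : ∀ P → (∀ k → coeff P k ≈ 0#) ⊎ Eventually (λ s → ¬ (P ⟨ fromℝ s ⟩ ≈ 0#))
    zero⊎eventually-nonzero P with lowestTerm P
    ... | inj₁ P≈0                      = inj₁ P≈0
    ... | inj₂ (k , a , Q , a≉0 , P≈)   = inj₂ (eventually-map nonzero (eventually-positive
          (isPolynomial-normSq (isPolynomialᶜ-+ (isPolynomialᶜ-const a)
            (isPolynomialᶜ-* isPolynomialᶜ-fromℝ (isPolynomialᶜ-⟨⟩ Q isPolynomialᶜ-fromℝ))))
          (<-respʳ-≈ (ℝ-sym (normSq-cong (solve 2 (λ a e → a :+ :0 :* e := a) refl a (Q ⟨ 0# ⟩))))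
            (0<normSq a≉0))))
      where
      nonzero : ∀ {s} → ℝ.0# ℝ.< s → ℝ.0# ℝ.< normSq (a + fromℝ s * Q ⟨ fromℝ s ⟩) →
                ¬ (P ⟨ fromℝ s ⟩ ≈ 0#)
      nonzero {s} 0<s 0<N P≈0 =
        *-≉0 (^-≉0 k λ s≈0 → irrefl (ℝ-sym (proj₁ s≈0)) 0<s) (0<normSq⇒≉0 0<N)
          (trans (sym (P≈ (fromℝ s))) P≈0)

  opaque
    fromℝ-^ : ∀ k {s} → ℝ.0# ℝ.< s → ∃[ r ] (ℝ.0# ℝ.< r × fromℝ s ^ k ≈ fromℝ r)
    fromℝ-^ zero        0<s = ℝ.1# , 0<1 , refl
    fromℝ-^ (suc k) {s} 0<s = step (fromℝ-^ k 0<s)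
      where
      step : ∃[ r ] (ℝ.0# ℝ.< r × fromℝ s ^ k ≈ fromℝ r) →
             ∃[ r ] (ℝ.0# ℝ.< r × fromℝ s ^ suc k ≈ fromℝ r)
      step (r , 0<r , s^k≈r) =
        s ℝ.* r , ℝ.*-positive 0<s 0<r , trans (*-congˡ s^k≈r) (fromℝ-* s r)

  -- If P vanishes at 0 but Q does not, then P / Q behaves like c tᵏ with
  -- k ≥ 1 near 0, and so enters the lower half-plane along some ray.
  opaque
    eventually-cross<0 : ∀ P Q → HasLowestTerm P → P ⟨ 0# ⟩ ≈ 0# → ¬ (Q ⟨ 0# ⟩ ≈ 0#) →
                         ∃[ ω ] Eventually (λ s → cross (P ⟨ fromℝ s * ω ⟩) (Q ⟨ fromℝ s * ω ⟩) ℝ.< ℝ.0#)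
    eventually-cross<0 P Q (zero  , a , B , a≉0 , P≈) P0≈0 Q0≉0 = contradiction
      (begin
        a                               ≈⟨ solve 2 (λ a e → a := :1 :* (a :+ :0 :* e)) refl a (B ⟨ 0# ⟩) ⟩
        0# ^ 0 * (a + 0# * B ⟨ 0# ⟩)    ≈⟨ P≈ 0# ⟨
        P ⟨ 0# ⟩                        ≈⟨ P0≈0 ⟩
        0#                              ∎) a≉0
    eventually-cross<0 P Q (suc k , a , B , a≉0 , P≈) P0≈0 Q0≉0 =
      -- The cross product of ωᵏ⁺¹ a and b is the imaginary part of ωᵏ⁺¹ a `conj b`, so the
      -- direction is chosen for a `conj b`.
      along (direction-into-lower-half-plane (suc k) ℕ.z<s (*-≉0 a≉0 (conj-≉0 Q0≉0)))
      where
      b : ℂ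
      b = Q ⟨ 0# ⟩

      along : ∃[ ω ] (im (ω ^ suc k * (a * conj b)) ℝ.< ℝ.0#) →
              ∃[ ω ] Eventually (λ s → cross (P ⟨ fromℝ s * ω ⟩) (Q ⟨ fromℝ s * ω ⟩) ℝ.< ℝ.0#)
      along (ω , im<0) = ω , eventually-map negative
        (eventually-negative (isPolynomial-cross leading-poly (isPolynomialᶜ-⟨⟩ Q ray))
          (<-respˡ-≈ leading≈ im<0))
        where
        ray : IsPolynomialᶜ (λ s → fromℝ s * ω)
        ray = isPolynomialᶜ-* isPolynomialᶜ-fromℝ (isPolynomialᶜ-const ω)

        -- P(s ω) is sᵏ⁺¹ times `leading s`. Without this positive factor the cross product is
        -- already negative at s = 0, and the sign persists nearby.
        leading : ℝ.Carrier → ℂ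
        leading s = ω ^ suc k * (a + (fromℝ s * ω) * B ⟨ fromℝ s * ω ⟩)

        leading-poly : IsPolynomialᶜ leading
        leading-poly = isPolynomialᶜ-* (isPolynomialᶜ-const (ω ^ suc k))
          (isPolynomialᶜ-+ (isPolynomialᶜ-const a) (isPolynomialᶜ-* ray (isPolynomialᶜ-⟨⟩ B ray)))

        leading≈ : im (ω ^ suc k * (a * conj b)) ℝ.≈ cross (leading ℝ.0#) (Q ⟨ fromℝ ℝ.0# * ω ⟩)
        leading≈ = ℝ-trans
          (proj₂ (solve 3 (λ x a b → x :* (a :* b) := (x :* a) :* b) refl (ω ^ suc k) a (conj b)))
          (ℝ-trans (im-*-conj (ω ^ suc k * a) b) (cross-cong
            (sym (*-congˡ (solve 3 (λ a ω e → a :+ (:0 :* ω) :* e := a) refl a ω (B ⟨ 0# * ω ⟩))))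
            (eval-congʳ 1 Q (sym (zeroˡ ω) ∷ []))))

        negative : ∀ {s} → ℝ.0# ℝ.< s → cross (leading s) (Q ⟨ fromℝ s * ω ⟩) ℝ.< ℝ.0# →
                   cross (P ⟨ fromℝ s * ω ⟩) (Q ⟨ fromℝ s * ω ⟩) ℝ.< ℝ.0#
        negative {s} 0<s cross<0 = scaled (fromℝ-^ (suc k) 0<s)
          where
          t : ℂ
          t = fromℝ s * ω
          scaled : ∃[ r ] (ℝ.0# ℝ.< r × fromℝ s ^ suc k ≈ fromℝ r) → cross (P ⟨ t ⟩) (Q ⟨ t ⟩) ℝ.< ℝ.0#
          scaled (r , 0<r , s^k≈r) = <-respˡ-≈
            (ℝ-sym (ℝ-trans (cross-cong {w = Q ⟨ t ⟩} P≈r*leading refl)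
                            (cross-scale r (leading s) (Q ⟨ t ⟩))))
            (*-positive-negative 0<r cross<0)
            where
            P≈r*leading : P ⟨ t ⟩ ≈ fromℝ r * leading s
            P≈r*leading = begin
              P ⟨ t ⟩                                            ≈⟨ P≈ t ⟩
              t ^ suc k * (a + t * B ⟨ t ⟩)                      ≈⟨ *-congʳ
                (^-distrib-* (fromℝ s) ω (suc k)) ⟩
              (fromℝ s ^ suc k * ω ^ suc k) * (a + t * B ⟨ t ⟩)  ≈⟨ *-congʳ (*-congʳ s^k≈r) ⟩
              (fromℝ r * ω ^ suc k) * (a + t * B ⟨ t ⟩)          ≈⟨ solve 3 (λ r x e →
                (r :* x) :* e := r :* (x :* e)) refl (fromℝ r) (ω ^ suc k) (a + t * B ⟨ t ⟩) ⟩
              fromℝ r * leading s                                ∎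

-- Vanishing of polynomials, restriction to lines, and the minimum principle.

module StablePolynomials {c ℓ₁ ℓ₂} (ℝ : CompleteOrderedField c ℓ₁ ℓ₂) where
  private module ℝ = CompleteOrderedField ℝ
  open Complex ℝ
  open Multivariate ℂ-rawRing using (alongLine; constant; variables)
  open Real ℝ
  open ComplexPlane ℝ
  open ComplexPolynomials ℝ
  open CommutativeRing ℂ-commutativeRing
    using (_≈_; _+_; _*_; -_; _-_; 0#; 1#; setoid; refl; sym; trans; +-cong; +-congˡ; +-congʳ;
           *-congˡ; *-congʳ; -‿cong; +-identityˡ; +-identityʳ; -‿inverseʳ; zeroˡ; zeroʳ)
  open CommutativeRing ℝ-commutativeRing using () renaming (trans to ℝ-trans)
  open IntegerSolver ℂ-commutativeRing
  open Evaluation ℂ-commutativeRing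
  open SetoidReasoning setoid

  open Univariate ℂ-rawRing using (coeff; degree; add)
  private
    coeffₙ : ∀ n → Poly (suc n) → ℕ → Poly n
    coeffₙ n = Univariate.coeff (ℂ-rawRing [X^ n ])

  IsZero : ∀ n → Poly n → Set ℓ₁
  IsZero n p = RawRing._≈_ (ℂ-rawRing [X^ n ]) p (RawRing.0# (ℂ-rawRing [X^ n ]))

  ⟨⟩-zero : ∀ P t → (∀ k → coeff P k ≈ 0#) → P ⟨ t ⟩ ≈ 0#
  ⟨⟩-zero P t = Eval.⟦⟧-cong (t ∷ []) {P} {[]}

  coefficients-vanish : ∀ P → (∀ t → P ⟨ t ⟩ ≈ 0#) → ∀ k → coeff P k ≈ 0#
  coefficients-vanish P P≈0 with zero⊎eventually-nonzero P
  ... | inj₁ coeffs≈0 = coeffs≈0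
  ... | inj₂ nonzero with eventually⇒∃ nonzero
  ...   | s , _ , Ps≉0 = contradiction (P≈0 (fromℝ s)) Ps≉0

  coeff-add : ∀ P Q k → coeff (add P Q) k ≈ coeff P k + coeff Q k
  coeff-add []      Q       k       = sym (+-identityˡ _)
  coeff-add (x ∷ P) []      k       = sym (+-identityʳ _)
  coeff-add (x ∷ P) (y ∷ Q) zero    = refl
  coeff-add (x ∷ P) (y ∷ Q) (suc k) = coeff-add P Q k

  coeff-neg : ∀ P k → coeff (map (-_) P) k ≈ - coeff P k
  coeff-neg []      k       = solve 0 (:0 := :- :0) refl
  coeff-neg (x ∷ P) zero    = refl
  coeff-neg (x ∷ P) (suc k) = coeff-neg P k

  coefficients-agree : ∀ P Q → (∀ t → P ⟨ t ⟩ ≈ Q ⟨ t ⟩) → ∀ k → coeff P k ≈ coeff Q k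
  coefficients-agree P Q P≈Q k = begin
    coeff P k                                       ≈⟨ solve 2 (λ p q → p := (p :- q) :+ q) refl _ _ ⟩
    (coeff P k - coeff Q k) + coeff Q k             ≈⟨ +-congʳ (+-congˡ (coeff-neg Q k)) ⟨
    (coeff P k + coeff (map (-_) Q) k) + coeff Q k  ≈⟨ +-congʳ (coeff-add P (map (-_) Q) k) ⟨
    coeff (add P (map (-_) Q)) k + coeff Q k        ≈⟨ +-congʳ (coefficients-vanish
                                                         (add P (map (-_) Q)) difference k) ⟩
    0# + coeff Q k                                  ≈⟨ +-identityˡ _ ⟩
    coeff Q k                                       ∎
    where
    difference : ∀ t → add P (map (-_) Q) ⟨ t ⟩ ≈ 0#
    difference t = begin
      add P (map (-_) Q) ⟨ t ⟩        ≈⟨ Eval.+-homo (t ∷ []) P (map (-_) Q) ⟩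
      P ⟨ t ⟩ + map (-_) Q ⟨ t ⟩      ≈⟨ +-cong (P≈Q t) (Eval.-‿homo (t ∷ []) Q) ⟩
      Q ⟨ t ⟩ - Q ⟨ t ⟩               ≈⟨ -‿inverseʳ _ ⟩
      0#                              ∎

  degree-⊥ : ∀ P → degree _≟ᶜ_ P ≡ ⊥₋ → ∀ k → coeff P k ≈ 0#
  degree-⊥ []      _ k = refl
  degree-⊥ (x ∷ P) eq k with degree _≟ᶜ_ P in eq′ | x ≟ᶜ 0#
  degree-⊥ (x ∷ P) eq zero    | ⊥₋ | yes x≈0 = x≈0
  degree-⊥ (x ∷ P) eq (suc k) | ⊥₋ | yes x≈0 = degree-⊥ P eq′ k

  coeff-above-degree : ∀ P {d} → degree _≟ᶜ_ P ≤₋ [ d ] → ∀ {k} → d ℕ.< k → coeff P k ≈ 0#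
  coeff-above-degree []      _ _ = refl
  coeff-above-degree (x ∷ P) deg≤d {suc k} d<k with degree _≟ᶜ_ P in eq | x ≟ᶜ 0#
  ... | ⊥₋    | _ = degree-⊥ P eq k
  coeff-above-degree (x ∷ P) [ ℕ.s≤s e≤d ] {suc k} (ℕ.s≤s d<k) | [ e ] | _ =
    coeff-above-degree P (≡.subst (_≤₋ _) (≡.sym eq) [ e≤d ]) d<k

  module _ {n : ℕ} where

    specialise : Vec ℂ n → Poly (suc n) → Poly 1
    specialise w = map (λ q → eval n q w)

    specialise-⟨⟩ : ∀ w p t → specialise w p ⟨ t ⟩ ≈ eval (suc n) p (t ∷ w)
    specialise-⟨⟩ w []      t = refl
    specialise-⟨⟩ w (q ∷ p) t = begin
      specialise w (q ∷ p) ⟨ t ⟩              ≈⟨ eval-∷ 0 (eval n q w) (specialise w p) t [] ⟩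
      eval n q w + t * specialise w p ⟨ t ⟩   ≈⟨ +-congˡ (*-congˡ (specialise-⟨⟩ w p t)) ⟩
      eval n q w + t * eval (suc n) p (t ∷ w) ≈⟨ eval-∷ n q p t w ⟨
      eval (suc n) (q ∷ p) (t ∷ w)            ∎

    coeff-specialise : ∀ w p k → coeff (specialise w p) k ≈ eval n (coeffₙ n p k) w
    coeff-specialise w []      k       = sym (Eval.0#-homo w)
    coeff-specialise w (q ∷ p) zero    = refl
    coeff-specialise w (q ∷ p) (suc k) = coeff-specialise w p k

  -- Fixing the inner variables at w leaves a univariate polynomial whose values are all zero. Its
  -- coefficients are the values at w of the coefficient polynomials, to which induction applies.
  vanishing⇒zero : ∀ n (p : Poly n) → (∀ w → eval n p w ≈ 0#) → IsZero n p
  vanishing⇒zero zero    p p≈0 = p≈0 []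
  vanishing⇒zero (suc n) p p≈0 k = vanishing⇒zero n (coeffₙ n p k) λ w →
    trans (sym (coeff-specialise w p k)) (coefficients-vanish (specialise w p)
      (λ t → trans (specialise-⟨⟩ w p t) (p≈0 (t ∷ w))) k)

  zero? : ∀ n (p : Poly n) → Dec (IsZero n p)
  zero? zero    p       = p ≟ᶜ 0#
  zero? (suc n) []      = yes λ _ → vanishing⇒zero n _ Eval.0#-homo
  zero? (suc n) (q ∷ p) = map′ (λ { (q≈0 , p≈0) zero → q≈0 ; (q≈0 , p≈0) (suc k) → p≈0 k })
    (λ q∷p≈0 → q∷p≈0 0 , q∷p≈0 ∘ suc) (zero? n q ×-dec zero? (suc n) p)

  line : ∀ n → Poly n → Vec ℂ n → Vec ℂ n → Poly 1
  line = alongLine ℂ-rawRing id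

  line-⟨⟩ : ∀ n p w v t → line n p w v ⟨ t ⟩ ≈ eval n p (w +[ t ] v)
  line-⟨⟩ n p w v t = eval-alongLine p w v t [] (Pointwise.refl refl)

  infix 6 _⇾_
  _⇾_ : ∀ {n} → Vec ℂ n → Vec ℂ n → Vec ℂ n
  w ⇾ w′ = Vec.zipWith (λ x y → y - x) w w′

  +[0] : ∀ {n} (w v : Vec ℂ n) → Pointwise _≈_ (w +[ 0# ] v) w
  +[0] []      []      = []
  +[0] (x ∷ w) (y ∷ v) = solve 2 (λ x y → x :+ :0 :* y := x) refl x y ∷ +[0] w v

  +[1]⇾ : ∀ {n} (w w′ : Vec ℂ n) → Pointwise _≈_ (w +[ 1# ] (w ⇾ w′)) w′
  +[1]⇾ []      []       = []
  +[1]⇾ (x ∷ w) (y ∷ w′) = solve 2 (λ x y → x :+ :1 :* (y :- x) := y) refl x y ∷ +[1]⇾ w w′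

  line-⟨0⟩ : ∀ n p w v → line n p w v ⟨ 0# ⟩ ≈ eval n p w
  line-⟨0⟩ n p w v = trans (line-⟨⟩ n p w v 0#) (eval-congʳ n p (+[0] w v))

  line-⟨1⟩ : ∀ n p w w′ → line n p w (w ⇾ w′) ⟨ 1# ⟩ ≈ eval n p w′
  line-⟨1⟩ n p w w′ = trans (line-⟨⟩ n p w (w ⇾ w′) 1#) (eval-congʳ n p (+[1]⇾ w w′))

  -- Suppose p(w) ≠ 0 and q(w′) ≠ 0. On the line through w and w′ neither restriction is the zero
  -- polynomial, as t = 0 and t = 1 show. So both are nonzero at a common small s, against the
  -- assumption that p vanishes where q does not.
  vanishes-generically⇒vanishes : ∀ n (p : Poly n) → Generically n (λ w → eval n p w ≈ 0#) →
                                  ∀ w → eval n p w ≈ 0#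
  vanishes-generically⇒vanishes n p (q , q≉0 , p≈0) w =
    decidable-stable (eval n p w ≟ᶜ 0#) λ pw≉0 →
      q≉0 (vanishing⇒zero n q λ w′ → decidable-stable (eval n q w′ ≟ᶜ 0#) (common-nonzero pw≉0 w′))
    where
    common-nonzero : ¬ (eval n p w ≈ 0#) → ∀ w′ → ¬ ¬ (eval n q w′ ≈ 0#)
    common-nonzero pw≉0 w′ qw′≉0
      with zero⊎eventually-nonzero (line n p w (w ⇾ w′)) | zero⊎eventually-nonzero (line n q w (w ⇾ w′))
    ... | inj₁ P≈0 | _ = pw≉0 (trans (sym (line-⟨0⟩ n p w (w ⇾ w′)))
          (⟨⟩-zero (line n p w (w ⇾ w′)) 0# P≈0))
    ... | inj₂ _ | inj₁ Q≈0 = qw′≉0 (trans (sym (line-⟨1⟩ n q w w′))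
          (⟨⟩-zero (line n q w (w ⇾ w′)) 1# Q≈0))
    ... | inj₂ P≉0 | inj₂ Q≉0 with eventually⇒∃ (eventually-× P≉0 Q≉0)
    ...   | s , _ , Ps≉0 , Qs≉0 = Ps≉0 (trans (line-⟨⟩ n p w (w ⇾ w′) (fromℝ s))
            (p≈0 (w +[ fromℝ s ] (w ⇾ w′)) (Qs≉0 ∘ trans (line-⟨⟩ n q w (w ⇾ w′) (fromℝ s)))))

  -- Openness of ℍⁿ along a ray: the imaginary part of each coordinate is a real polynomial in s,
  -- positive at 0.
  eventually-in-upper-half-plane : ∀ {n} ω (z u : Vec ℂ n) → All InUpperHalfPlane z →
    Eventually (λ s → All InUpperHalfPlane (z +[ fromℝ s * ω ] u))
  eventually-in-upper-half-plane ω []      []      []          = ℝ.1# , 0<1 , λ _ _ _ → []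
  eventually-in-upper-half-plane ω (x ∷ z) (y ∷ u) (0<x ∷ 0<z) =
    eventually-map (λ _ → uncurry _∷_) (eventually-×
      (eventually-positive
        (proj₂ (isPolynomialᶜ-+ (isPolynomialᶜ-const x)
          (isPolynomialᶜ-* (isPolynomialᶜ-* isPolynomialᶜ-fromℝ (isPolynomialᶜ-const ω))
            (isPolynomialᶜ-const y))))
        (<-respʳ-≈ (proj₂ (solve 3 (λ x ω y → x := x :+ (:0 :* ω) :* y) refl x ω y)) 0<x))
      (eventually-in-upper-half-plane ω z u 0<z))

  -- A minimum principle for Im (p / q).
  numerator-vanishes : ∀ n (p q : Poly n) →
    (∀ z → All InUpperHalfPlane z → ¬ (cross (eval n p z) (eval n q z) ℝ.< ℝ.0#)) →
    ∀ z → All InUpperHalfPlane z → eval n p z ≈ 0# → ¬ (eval n q z ≈ 0#) →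
    ∀ w → eval n p w ≈ 0#
  numerator-vanishes n p q cross≮0 z 0<z pz≈0 qz≉0 w =
    decidable-stable (eval n p w ≟ᶜ 0#) absurd
    where
    P = line n p z (z ⇾ w)
    Q = line n q z (z ⇾ w)

    absurd : ¬ ¬ (eval n p w ≈ 0#)
    absurd pw≉0 with lowestTerm P
    ... | inj₁ P≈0 = pw≉0 (trans (sym (line-⟨1⟩ n p z w)) (⟨⟩-zero P 1# P≈0))
    ... | inj₂ lowest = along (eventually-cross<0 P Q lowest
            (trans (line-⟨0⟩ n p z (z ⇾ w)) pz≈0) (qz≉0 ∘ trans (sym (line-⟨0⟩ n q z (z ⇾ w)))))
      where
      along : ¬ (∃[ ω ] Eventually (λ s → cross (P ⟨ fromℝ s * ω ⟩) (Q ⟨ fromℝ s * ω ⟩) ℝ.< ℝ.0#))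
      along (ω , cross<0)
        with eventually⇒∃ (eventually-× cross<0 (eventually-in-upper-half-plane ω z (z ⇾ w) 0<z))
      ... | s , _ , cross<0 , 0<z′ = cross≮0 _ 0<z′ (<-respˡ-≈
        (cross-cong (line-⟨⟩ n p z (z ⇾ w) (fromℝ s * ω)) (line-⟨⟩ n q z (z ⇾ w) (fromℝ s * ω)))
        cross<0)

  -- Affine behaviour of f in direction v.

  module _ {n : ℕ} where
    open Univariate (ℂ-rawRing [X^ n ]) using (evalAt; derivative)
    open RawRing (ℂ-rawRing [X^ n ]) using () renaming (0# to 0ₙ)

    -- Without the terms in t², t³, ... only X + t Y is left at w, and Y is the value at w of the
    -- t-derivative at 0.
    affine : ∀ (L : Poly (suc n)) w → (∀ k → eval n (coeffₙ n L (suc (suc k))) w ≈ 0#) → ∀ t →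
             eval (suc n) L (t ∷ w)
             ≈ eval (suc n) L (0# ∷ w) + t * eval n (evalAt 0ₙ (derivative L)) w
    affine []          w _ t = begin
      0#                                  ≈⟨ solve 1 (λ t → :0 := :0 :+ t :* :0) refl t ⟩
      0# + t * 0#                         ≈⟨ +-congˡ (*-congˡ (Eval.0#-homo w)) ⟨
      0# + t * eval n 0ₙ w                ∎
    affine (x ∷ [])    w _ t = begin
      eval n x w + t * 0#                                   ≈⟨ solve 2 (λ x t →
        x :+ t :* :0 := (x :+ :0 :* :0) :+ t :* :0) refl (eval n x w) t ⟩
      (eval n x w + 0# * 0#) + t * 0#                       ≈⟨ +-congˡ (*-congˡ (Eval.0#-homo w)) ⟨
      (eval n x w + 0# * 0#) + t * eval n 0ₙ w              ∎
    affine (x ∷ y ∷ r) w higher≈0 t = begin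
      eval (suc n) (x ∷ y ∷ r) (t ∷ w)                  ≈⟨ expand t ⟩
      X + t * Y                                         ≈⟨ solve 3 (λ x t y →
        x :+ t :* y := (x :+ :0 :* y) :+ t :* ((y :+ :0) :+ :0 :* :0)) refl X t Y ⟩
      (X + 0# * Y) + t * ((Y + 0#) + 0# * 0#)           ≈⟨ +-cong (expand 0#) (*-congˡ slope) ⟨
      eval (suc n) (x ∷ y ∷ r) (0# ∷ w) + t * eval n (evalAt 0ₙ (derivative (x ∷ y ∷ r))) w ∎
      where
      X = eval n x w
      Y = eval n y w

      expand : ∀ t → eval (suc n) (x ∷ y ∷ r) (t ∷ w) ≈ X + t * Y
      expand t = begin
        eval (suc n) (x ∷ y ∷ r) (t ∷ w)              ≈⟨ eval-∷ n x (y ∷ r) t w ⟩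
        X + t * eval (suc n) (y ∷ r) (t ∷ w)          ≈⟨ +-congˡ (*-congˡ (eval-∷ n y r t w)) ⟩
        X + t * (Y + t * eval (suc n) r (t ∷ w))      ≈⟨ +-congˡ (*-congˡ (+-congˡ (*-congˡ r≈0))) ⟩
        X + t * (Y + t * 0#)                          ≈⟨ solve 3 (λ x t y →
          x :+ t :* (y :+ t :* :0) := x :+ t :* y) refl X t Y ⟩
        X + t * Y                                     ∎
        where
        r≈0 : eval (suc n) r (t ∷ w) ≈ 0#
        r≈0 = trans (sym (specialise-⟨⟩ w r t)) (⟨⟩-zero (specialise w r) t
          (λ k → trans (coeff-specialise w r k) (higher≈0 k)))

      -- The constant coefficient of the derivative is `1 · y`, which unfolds to y plus zero; all
      -- later ones are multiplied by the point 0.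
      slope : eval n (evalAt 0ₙ (derivative (x ∷ y ∷ r))) w ≈ (Y + 0#) + 0# * 0#
      slope = trans (Eval.+-homo w _ _) (+-cong
        (trans (Eval.+-homo w y _) (+-congˡ (Eval.0#-homo w)))
        (trans (Eval.*-homo w _ _) (trans (*-congʳ (Eval.0#-homo w)) (trans (zeroˡ _) (sym (zeroˡ 0#))))))

  -- The coefficients of f(z + t v) in t are polynomials in z. Those of t², t³, ... vanish at
  -- generic w by the degree bound, hence at every w.
  affine-along : ∀ n (f : Poly n) v d → ρ n v f d → d ≤₋ [ 1 ] → ∀ w t →
                 eval n f (w +[ t ] Vec.map fromℝ v) ≈ eval n f w + t * eval n (∂ n v f) w
  affine-along n f v d (q , q≉0 , degree≡d) d≤1 w t = begin
    eval n f (w +[ t ] v′)                            ≈⟨ L-⟨⟩ w t ⟨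
    eval (suc n) L (t ∷ w)                            ≈⟨ affine L w higher≈0 t ⟩
    eval (suc n) L (0# ∷ w) + t * eval n (∂ n v f) w  ≈⟨ +-congʳ (L-⟨⟩ w 0#) ⟩
    eval n f (w +[ 0# ] v′) + t * eval n (∂ n v f) w  ≈⟨ +-congʳ (eval-congʳ n f (+[0] w v′)) ⟩
    eval n f w + t * eval n (∂ n v f) w               ∎
    where
    v′ = Vec.map fromℝ v
    L : Poly (suc n)
    L = alongLine (ℂ-rawRing [X^ n ]) (constant n) n f (variables n) v′

    L-⟨⟩ : ∀ w t → eval (suc n) L (t ∷ w) ≈ eval n f (w +[ t ] v′)
    L-⟨⟩ w t = eval-alongLine f (variables n) v′ t w (eval-variables w)

    higher≈0 : ∀ k → eval n (coeffₙ n L (suc (suc k))) w ≈ 0#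
    higher≈0 k = vanishes-generically⇒vanishes n (coeffₙ n L (suc (suc k)))
      (q , q≉0 , λ w qw≉0 → begin
        eval n (coeffₙ n L (suc (suc k))) w         ≈⟨ coeff-specialise w L (suc (suc k)) ⟨
        -- The line over ℂ[z] specialised at w and the line built over ℂ from w are constructed
        -- separately; equal values force equal coefficients.
        coeff (specialise w L) (suc (suc k))        ≈⟨ coefficients-agree (specialise w L) (line n f w v′)
          (λ t → trans (specialise-⟨⟩ w L t) (trans (L-⟨⟩ w t) (sym (line-⟨⟩ n f w v′ t)))) (suc (suc k)) ⟩
        coeff (line n f w v′) (suc (suc k))         ≈⟨ coeff-above-degree (line n f w v′)
          (≡.subst (_≤₋ [ 1 ]) (≡.sym (degree≡d w qw≉0)) d≤1) (ℕ.s≤s (ℕ.s≤s ℕ.z≤n)) ⟩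
        0#                                          ∎) w

  +[]-in-upper-half-plane : ∀ {n t} {z : Vec ℂ n} {v} → InUpperHalfPlane t → All InUpperHalfPlane z →
    All (ℝ._≤_ ℝ.0#) v → All InUpperHalfPlane (z +[ t ] Vec.map fromℝ v)
  +[]-in-upper-half-plane         0<t []                    []          = []
  +[]-in-upper-half-plane {t = t} 0<t (_∷_ {x = x} 0<x 0<z) (0≤y ∷ 0≤v) =
    shift-in-upper-half-plane {x} {t} 0<t 0<x 0≤y ∷ +[]-in-upper-half-plane {t = t} 0<t 0<z 0≤v

  -- Consequences of stability of g + y f.

  module _ {n : ℕ} (f g : Poly n)
           (g+yf≉0 : ∀ y z → InUpperHalfPlane y → All InUpperHalfPlane z →
                     ¬ (eval n g z + y * eval n f z ≈ 0#))
           where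

    -- Otherwise y = -g(z) / f(z) would be a root in the upper half-plane.
    cross-g-f≮0 : ∀ z → All InUpperHalfPlane z → ¬ (cross (eval n g z) (eval n f z) ℝ.< ℝ.0#)
    cross-g-f≮0 z 0<z cross<0 with cross<0⇒root (eval n g z) (eval n f z) cross<0
    ... | y , 0<y , root = g+yf≉0 y z 0<y 0<z root

    -- As f is the one with a zero, it has to be the numerator: -f / g inherits the sign condition
    -- from g / f. The denominator satisfies g(z) ≠ 0, since otherwise g + 𝕚 f would vanish at z.
    zero-propagates : ∀ z → All InUpperHalfPlane z → eval n f z ≈ 0# → ∀ w → eval n f w ≈ 0#
    zero-propagates z 0<z fz≈0 w = begin
      eval n f w          ≈⟨ solve 1 (λ x → x := :- :- x) refl (eval n f w) ⟩
      - (- eval n f w)    ≈⟨ -‿cong (Eval.-‿homo w f) ⟨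
      - eval n (-ₙ f) w   ≈⟨ -‿cong (numerator-vanishes n (-ₙ f) g cross≮0 z 0<z -fz≈0 gz≉0 w) ⟩
      - 0#                ≈⟨ solve 0 (:- :0 := :0) refl ⟩
      0#                  ∎
      where
      open RawRing (ℂ-rawRing [X^ n ]) using () renaming (-_ to -ₙ_)

      cross≮0 : ∀ z → All InUpperHalfPlane z → ¬ (cross (eval n (-ₙ f) z) (eval n g z) ℝ.< ℝ.0#)
      cross≮0 z 0<z = cross-g-f≮0 z 0<z ∘ <-respˡ-≈
        (ℝ-trans (cross-cong {w = eval n g z} (Eval.-‿homo z f) refl)
                 (cross-neg (eval n f z) (eval n g z)))

      -fz≈0 : eval n (-ₙ f) z ≈ 0#
      -fz≈0 = trans (Eval.-‿homo z f) (trans (-‿cong fz≈0) (solve 0 (:- :0 := :0) refl))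

      gz≉0 : ¬ (eval n g z ≈ 0#)
      gz≉0 gz≈0 = g+yf≉0 𝕚 z 0<1 0<z
        (trans (+-cong gz≈0 (*-congˡ fz≈0)) (trans (+-identityˡ _) (zeroʳ 𝕚)))

    module _ (D : Poly n) (v : Vec ℝ.Carrier n) (0≤v : All (ℝ._≤_ ℝ.0#) v)
             (f-affine : ∀ w t → eval n f (w +[ t ] Vec.map fromℝ v) ≈ eval n f w + t * eval n D w)
             where
      open RawRing (ℂ-rawRing [X^ n ]) using () renaming (_+_ to _+ₙ_; -_ to -ₙ_)

      eval-difference : ∀ z → eval n (g +ₙ (-ₙ D)) z ≈ eval n g z - eval n D z
      eval-difference z = trans (Eval.+-homo z g (-ₙ D)) (+-congˡ (Eval.-‿homo z D))

      difference-propagates : ∀ z → All InUpperHalfPlane z → eval n (g +ₙ (-ₙ D)) z ≈ 0# →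
                              ∀ w → eval n (g +ₙ (-ₙ D)) w ≈ 0#
      difference-propagates z 0<z hz≈0 with eval n f z ≟ᶜ 0#
      -- Now f vanishes everywhere, so 0 = f(z + v) = f(z) + D(z) gives D(z) = 0. Hence g(z) = D(z)
      -- = 0, which contradicts stability at y = 𝕚.
      ... | yes fz≈0 = contradiction (begin
        eval n g z + 𝕚 * eval n f z           ≈⟨ +-cong gz≈Dz (*-congˡ fz≈0) ⟩
        eval n D z + 𝕚 * 0#                   ≈⟨ solve 2 (λ d i →
          d :+ i :* :0 := :0 :+ :1 :* d) refl (eval n D z) 𝕚 ⟩
        0# + 1# * eval n D z                  ≈⟨ +-congʳ fz≈0 ⟨
        eval n f z + 1# * eval n D z          ≈⟨ f-affine z 1# ⟨
        eval n f (z +[ 1# ] Vec.map fromℝ v)  ≈⟨ zero-propagates z 0<z fz≈0 _ ⟩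
        0#                                    ∎) (g+yf≉0 𝕚 z 0<1 0<z)
        where
        gz≈Dz : eval n g z ≈ eval n D z
        gz≈Dz = begin
          eval n g z                              ≈⟨ solve 2 (λ g d → g := (g :- d) :+ d) refl _ _ ⟩
          (eval n g z - eval n D z) + eval n D z  ≈⟨ +-congʳ (trans (sym (eval-difference z)) hz≈0) ⟩
          0# + eval n D z                         ≈⟨ +-identityˡ _ ⟩
          eval n D z                              ∎
      ... | no fz≉0 = numerator-vanishes n (g +ₙ (-ₙ D)) f
            (λ z′ 0<z′ → cross-minus (eval n g z′) (eval n f z′) (eval n D z′)
                (cross-g-f≮0 z′ 0<z′) (cross-f-D≮0 z′ 0<z′)
              ∘ <-respˡ-≈ (cross-cong {w = eval n f z′} (eval-difference z′) refl))
            z 0<z hz≈0 fz≉0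
        where
        -- A negative sign would give t = -f(z′) / D(z′) in the upper half-plane with f(z′ + t v) =
        -- 0. This zero lies in ℍⁿ and would spread to z, where f is nonzero.
        cross-f-D≮0 : ∀ z′ → All InUpperHalfPlane z′ → ¬ (cross (eval n f z′) (eval n D z′) ℝ.< ℝ.0#)
        cross-f-D≮0 z′ 0<z′ cross<0 with cross<0⇒root (eval n f z′) (eval n D z′) cross<0
        ... | t , 0<t , root = fz≉0 (zero-propagates (z′ +[ t ] Vec.map fromℝ v)
              (+[]-in-upper-half-plane {t = t} 0<t 0<z′ 0≤v) (trans (f-affine z′ t) root) z)

-- Stability or identical vanishing of g - ∂_v f.

corollary3p6 : ∀ {c ℓ₁ ℓ₂} (ℝ : CompleteOrderedField c ℓ₁ ℓ₂) (n : ℕ) →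
    let open Complex ℝ
        module ℝ = CompleteOrderedField ℝ
        module ℂ[z] = RawRing (ℂ-rawRing [X^ n ])
        module ℂ[y,z] = RawRing (ℂ-rawRing [X^ suc n ])
        open Univariate (ℂ-rawRing [X^ n ]) using (const) renaming (X to y)
    in
    (f g : Poly n) →
    Stable (suc n) (const g ℂ[y,z].+ (y ℂ[y,z].* const f)) →
    (v : Vec ℝ.Carrier n) → All (λ vⱼ → ℝ.0# ℝ.≤ vⱼ) v →
    (d : ℕ ₋) → ρ n v f d → d ≤₋ [ 1 ] →
    let h = g ℂ[z].+ (ℂ[z].- ∂ n v f) in
    Stable n h ⊎ (h ℂ[z].≈ ℂ[z].0#)
corollary3p6 ℝ n f g stable v 0≤v d ρ≡d d≤1 = dichotomy (zero? n h)
  where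
  open Complex ℝ
  open ComplexPlane ℝ using (ℂ-commutativeRing; InUpperHalfPlane)
  open CommutativeRing ℂ-commutativeRing
  open Evaluation ℂ-commutativeRing
  open StablePolynomials ℝ
  open Univariate (ℂ-rawRing [X^ n ]) using (const) renaming (X to Y)
  module ℂ[z] = RawRing (ℂ-rawRing [X^ n ])
  module ℂ[y,z] = RawRing (ℂ-rawRing [X^ suc n ])

  h : Poly n
  h = g ℂ[z].+ (ℂ[z].- ∂ n v f)

  g+yf≉0 : ∀ y z → InUpperHalfPlane y → All InUpperHalfPlane z →
           ¬ (eval n g z + y * eval n f z ≈ 0#)
  g+yf≉0 y z 0<y 0<z root = stable (y ∷ z) (0<y ∷ 0<z) (trans
    (trans (Eval.+-homo (y ∷ z) (const g) (Y ℂ[y,z].* const f))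
      (+-cong (eval-const g y z) (trans (Eval.*-homo (y ∷ z) Y (const f))
        (*-cong (eval-X y z) (eval-const f y z)))))
    root)

  dichotomy : Dec (IsZero n h) → Stable n h ⊎ IsZero n h
  dichotomy (yes h≈0) = inj₂ h≈0
  dichotomy (no  h≉0) = inj₁ λ z 0<z hz≈0 → h≉0 (vanishing⇒zero n h
    (difference-propagates f g g+yf≉0 (∂ n v f) v 0≤v (affine-along n f v d ρ≡d d≤1) z 0<z hz≈0))
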